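{- Let $G_{n,1/2}$ be the random graph on $n$ vertices. With high probability, $$HG(G_{n,1/2})\leq (1+o(1)) \left(\frac{1+\sqrt5}{4}\right)n .$$ That is, there is a function $\delta(n)$ with $\delta(n)\to 0$ as $n\to\infty$ such that $\Pr\left[HG(G_{n,1/2})\le (1+\delta(n))\frac{1+\sqrt5}{4}\,n\right]\to 1$ as $n\to\infty$.
   Context: $G_{n,1/2}$ denotes the random graph on $n$ labeled vertices in which each of the $\binom n2$ possible edges is present independently with probability $1/2$. "With high probability" means with probability tending to $1$ as $n\to\infty$. Graphs are finite and simple, with at least one vertex. Let $G$ be a graph on $n$ vertices and let $k\ge 1$ be an integer. A $k$-coloring of $G$ is an arbitrary (not necessarily proper) map $c:V(G)\to\{1,\ldots,k\}$ (hat colors). A guessing strategy $\mathcal{S}$ with $k$ colors is a deterministic rule assigning to each vertex $v$ a function that takes the colors $(c(w))_{w\in N(v)}$ of the neighbors of $v$ (not including $v$ itself) and outputs a guess in $\{1,\ldots,k\}$. Vertex $v$ guesses correctly in $c$ if its guess equals $c(v)$. The strategy is winning if for every $k$-coloring $c$ at least one vertex guesses correctly. The hat guessing number $HG(G)$ is the largest $k$ for which a winning guessing strategy with $k$ colors exists. -}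

module Defs where

open import Data.Bool.Base using (Bool; true; false; T; if_then_else_)
open import Data.Bool.Properties using (T?)
open import Data.Fin.Base using (Fin; zero; suc)
open import Data.Fin.Properties using () renaming (_≟_ to _≟ᶠ_; any? to anyᶠ?)
open import Data.Integer.Base using () renaming (+_ to pos)
open import Data.List.Base as List
  using (List; []; _∷_; length; filter; allFin; cartesianProductWith)
import Data.List.Properties as Listₚ
open import Data.List.Membership.Propositional.Properties using (∈-allFin)
open import Data.List.Relation.Unary.All as All using (All; []; _∷_)
open import Data.List.Relation.Unary.All.Properties using (all-filter)
open import Data.List.Relation.Unary.Any as Any using (Any; here; there)
import Data.List.Relation.Unary.Any.Properties as Anyₚ
open import Data.Nat.Base as ℕ using (ℕ; zero; suc; NonZero; z≤n; s≤s)
open import Data.Nat.Combinatorics using (_C_; nC1≡n; nCk+nC[k+1]≡[n+1]C[k+1])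
import Data.Nat.Properties as ℕₚ
open import Algebra.Properties.CommutativeMonoid.Sum ℕₚ.+-0-commutativeMonoid
  using (sum; ∑-comm)
open import Data.Product.Base using (∃; _×_; _,_; proj₁; proj₂)
open import Data.Rational.Base as ℚ using (ℚ; 0ℚ; 1ℚ)
import Data.Rational.Properties as ℚₚ
open import Data.Sum.Base using (_⊎_)
open import Data.Vec.Base as Vec using (Vec; []; _∷_; fromList; insertAt; lookup)
import Data.Vec.Properties as Vecₚ
open import Function.Base using (_∘_; const)
open import Relation.Binary.Core using (Rel)
open import Relation.Binary.PropositionalEquality
  using (_≡_; _≗_; refl; sym; trans; cong; cong₂; subst; module ≡-Reasoning)
open import Relation.Nullary using (Dec; yes; no; ¬_; does; map′; contradiction; _×-dec_; _⊎-dec_)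
open import Relation.Unary using (Pred; Decidable)
open import Level using (0ℓ)

------------------------------------------------------------------------
-- Finite simple graphs

record Graph (n : ℕ) : Set where
  field
    adj        : Fin n → Fin n → Bool
    adj-sym    : ∀ u v → adj u v ≡ adj v u
    adj-irrefl : ∀ v → adj v v ≡ false

open Graph public

neighbours : ∀ {n} → Graph n → Fin n → List (Fin n)
neighbours {n} G v = filter (λ w → T? (adj G v w)) (allFin n)

degree : ∀ {n} → Graph n → Fin n → ℕ
degree G v = length (neighbours G v)

------------------------------------------------------------------------
-- The hat guessing game

Colouring : ℕ → ℕ → Set
Colouring n k = Fin n → Fin k

-- The family (c(w)) indexed by w ∈ N(v), listed in increasing order of w.
view : ∀ {n k} (G : Graph n) → Colouring n k → (v : Fin n) → Vec (Fin k) (degree G v)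
view G c v = Vec.map c (fromList (neighbours G v))

Strategy : ∀ {n} → Graph n → ℕ → Set
Strategy {n} G k = (v : Fin n) → Vec (Fin k) (degree G v) → Fin k

GuessesCorrectly : ∀ {n k} (G : Graph n) → Strategy G k → Colouring n k → Fin n → Set
GuessesCorrectly G s c v = s v (view G c v) ≡ c v

Winning : ∀ {n k} (G : Graph n) → Strategy G k → Set
Winning {n} {k} G s = (c : Colouring n k) → ∃ λ v → GuessesCorrectly G s c v

HasWinningStrategy : ∀ {n} → Graph n → ℕ → Set
HasWinningStrategy G k = ∃ λ (s : Strategy G k) → Winning G s

IsHatGuessingNumber : ∀ {n} → Graph n → ℕ → Set
IsHatGuessingNumber G h =
  (1 ℕ.≤ h × HasWinningStrategy G h) × (∀ k → 1 ℕ.≤ k → HasWinningStrategy G k → k ℕ.≤ h)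

------------------------------------------------------------------------
-- Having a winning strategy is decidable: colourings and strategies can be
-- listed exhaustively up to pointwise equality.

record Listable {A : Set} (_≈_ : Rel A 0ℓ) : Set where
  field
    elements : List A
    complete : ∀ a → Any (a ≈_) elements

open Listable

module _ {A : Set} {_≈_ : Rel A 0ℓ} (L : Listable _≈_)
         {P : Pred A 0ℓ} (resp : ∀ {x y} → x ≈ y → P x → P y) (P? : Decidable P) where

  ∃-dec : Dec (∃ P)
  ∃-dec = map′ Any.satisfied
               (λ (a , pa) → Any.map (λ a≈x → resp a≈x pa) (complete L a))
               (Any.any? P? (elements L))

  ∀-dec : (∀ {x y} → x ≈ y → P y → P x) → Dec (∀ a → P a)
  ∀-dec resp⁻ = map′ (λ all a → let (px , a≈x) = All.lookupAny all (complete L a) in resp⁻ a≈x px)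
                     (λ p → All.universal p (elements L))
                     (All.all? P? (elements L))

fin-listable : ∀ k → Listable {Fin k} _≡_
fin-listable k .elements   = allFin k
fin-listable k .complete i = ∈-allFin i

cons : ∀ {n} {B : Fin (suc n) → Set} → B zero → (∀ i → B (suc i)) → ∀ i → B i
cons b f zero    = b
cons b f (suc i) = f i

Π-listable : ∀ {n} {B : Fin n → Set} {R : ∀ i → Rel (B i) 0ℓ} →
             (∀ i → Listable (R i)) →
             Listable {∀ i → B i} (λ f g → ∀ i → R i (f i) (g i))
Π-listable {zero}  L .elements   = (λ ()) ∷ []
Π-listable {zero}  L .complete f = here λ ()
Π-listable {suc n} L .elements   =
  cartesianProductWith cons (elements (L zero)) (elements (Π-listable (L ∘ suc)))
Π-listable {suc n} L .complete f =
  Anyₚ.cartesianProductWith⁺ cons (λ { p q zero → p ; p q (suc i) → q i })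
    (complete (L zero) (f zero)) (complete (Π-listable (L ∘ suc)) (f ∘ suc))

table-listable : ∀ k m → Listable {Vec (Fin k) m → Fin k} _≗_
table-listable k zero .elements   = List.map const (allFin k)
table-listable k zero .complete f =
  Anyₚ.map⁺ (Any.map (λ { eq [] → eq }) (∈-allFin (f [])))
table-listable k (suc m) .elements   =
  List.map (λ g xs → g (Vec.head xs) (Vec.tail xs))
           (elements (Π-listable {k} (λ _ → table-listable k m)))
table-listable k (suc m) .complete f =
  Anyₚ.map⁺ (Any.map (λ { eq (x ∷ xs) → eq x xs })
    (complete (Π-listable {k} (λ _ → table-listable k m)) (λ x xs → f (x ∷ xs))))

view-cong : ∀ {n k} (G : Graph n) {c c′ : Colouring n k} (v : Fin n) →
            (∀ w → T (adj G v w) → c w ≡ c′ w) → view G c v ≡ view G c′ v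
view-cong {n} {k} G {c} {c′} v eq = go (all-filter (λ w → T? (adj G v w)) (allFin n))
  where
  go : ∀ {ws} → All (λ w → T (adj G v w)) ws →
       Vec.map c (fromList ws) ≡ Vec.map c′ (fromList ws)
  go []       = refl
  go (p ∷ ps) = cong₂ _∷_ (eq _ p) (go ps)

winning? : ∀ {n k} (G : Graph n) → Decidable (Winning {k = k} G)
winning? {n} {k} G s =
  ∀-dec (Π-listable (λ _ → fin-listable k)) resp
        (λ c → anyᶠ? (λ v → s v (view G c v) ≟ᶠ c v))
        (λ eq → resp (sym ∘ eq))
  where
  resp : ∀ {c c′ : Colouring n k} → c ≗ c′ →
         ∃ (GuessesCorrectly G s c) → ∃ (GuessesCorrectly G s c′)
  resp eq (v , p) =
    v , trans (cong (s v) (sym (view-cong G v (λ w _ → eq w)))) (trans p (eq v))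

hasWinningStrategy? : ∀ {n} (G : Graph n) → Decidable (HasWinningStrategy G)
hasWinningStrategy? G k =
  ∃-dec (Π-listable (λ v → table-listable k (degree G v)))
        (λ eq win c → let (v , p) = win c in v , trans (sym (eq v _)) p)
        (winning? G)

------------------------------------------------------------------------
-- No winning strategy on n vertices uses more than n colours: each vertex
-- is right in exactly a 1/k fraction of the colourings.

module _ {k : ℕ} where

  Σᶜ : ∀ {n} → (Vec (Fin k) n → ℕ) → ℕ
  Σᶜ {zero}  f = f []
  Σᶜ {suc n} f = sum {k} λ a → Σᶜ (λ c → f (a ∷ c))

sum-mono : ∀ {n} {f g : Fin n → ℕ} → (∀ i → f i ℕ.≤ g i) → sum f ℕ.≤ sum g
sum-mono {zero}  le = z≤n
sum-mono {suc n} le = ℕₚ.+-mono-≤ (le zero) (sum-mono (le ∘ suc))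

sum-cong : ∀ {n} {f g : Fin n → ℕ} → f ≗ g → sum f ≡ sum g
sum-cong {zero}  eq = refl
sum-cong {suc n} eq = cong₂ ℕ._+_ (eq zero) (sum-cong (eq ∘ suc))

sum-const : ∀ n x → sum {n} (λ _ → x) ≡ n ℕ.* x
sum-const zero    x = refl
sum-const (suc n) x = cong (x ℕ.+_) (sum-const n x)

sum-term : ∀ {n} (f : Fin n → ℕ) i → f i ℕ.≤ sum f
sum-term f zero    = ℕₚ.m≤m+n _ _
sum-term f (suc i) = ℕₚ.≤-trans (sum-term (f ∘ suc) i) (ℕₚ.m≤n+m _ _)

module _ {k : ℕ} where

  Σᶜ-mono : ∀ {n} {f g : Vec (Fin k) n → ℕ} → (∀ c → f c ℕ.≤ g c) → Σᶜ f ℕ.≤ Σᶜ g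
  Σᶜ-mono {zero}  le = le []
  Σᶜ-mono {suc n} le = sum-mono λ a → Σᶜ-mono (λ c → le (a ∷ c))

  Σᶜ-one : ∀ n → Σᶜ {k} {n} (λ _ → 1) ≡ k ℕ.^ n
  Σᶜ-one zero    = refl
  Σᶜ-one (suc n) = trans (sum-cong {k} (λ _ → Σᶜ-one n)) (sum-const k _)

  Σᶜ-swap : ∀ {m} n (f : Fin m → Vec (Fin k) n → ℕ) →
            sum (λ i → Σᶜ (f i)) ≡ Σᶜ (λ c → sum (λ i → f i c))
  Σᶜ-swap zero    f = refl
  Σᶜ-swap (suc n) f = trans (∑-comm (λ i a → Σᶜ (λ c → f i (a ∷ c))))
                            (sum-cong (λ a → Σᶜ-swap n (λ i c → f i (a ∷ c))))

  Σᶜ-slice : ∀ {m} (v : Fin (suc m)) (f : Vec (Fin k) (suc m) → ℕ) →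
             (∀ c → sum (λ a → f (insertAt c v a)) ℕ.≤ 1) → Σᶜ f ℕ.≤ k ℕ.^ m
  Σᶜ-slice {m} zero f le = begin
    Σᶜ f                              ≡⟨ Σᶜ-swap m (λ a c → f (a ∷ c)) ⟩
    Σᶜ (λ c → sum (λ a → f (a ∷ c)))  ≤⟨ Σᶜ-mono le ⟩
    Σᶜ {k} {m} (λ _ → 1)              ≡⟨ Σᶜ-one m ⟩
    k ℕ.^ m                           ∎
    where open ℕₚ.≤-Reasoning
  Σᶜ-slice {suc m} (suc v) f le = begin
    Σᶜ f                     ≤⟨ sum-mono (λ a → Σᶜ-slice v (λ c → f (a ∷ c)) (λ c → le (a ∷ c))) ⟩
    sum {k} (λ _ → k ℕ.^ m)  ≡⟨ sum-const k _ ⟩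
    k ℕ.* k ℕ.^ m            ∎
    where open ℕₚ.≤-Reasoning

indicator : {P : Set} → Dec P → ℕ
indicator d = if does d then 1 else 0

indicator-yes : {P : Set} (d : Dec P) → P → 1 ℕ.≤ indicator d
indicator-yes (yes _) _ = s≤s z≤n
indicator-yes (no ¬p) p = contradiction p ¬p

indicator-sum : ∀ {k} (b : Fin k) → sum (λ a → indicator (b ≟ᶠ a)) ≡ 1
indicator-sum {suc k} zero    = cong suc (trans (sum-const k 0) (ℕₚ.*-zeroʳ k))
indicator-sum {suc k} (suc b) = indicator-sum b

lookup-insertAt-≢ : ∀ {A : Set} {n} (c : Vec A n) (v w : Fin (suc n)) {a a′ : A} →
                    ¬ w ≡ v → lookup (insertAt c v a) w ≡ lookup (insertAt c v a′) w
lookup-insertAt-≢ c       zero    zero    w≢v = contradiction refl w≢v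
lookup-insertAt-≢ c       zero    (suc w) w≢v = refl
lookup-insertAt-≢ (x ∷ c) (suc v) zero    w≢v = refl
lookup-insertAt-≢ (x ∷ c) (suc v) (suc w) w≢v = lookup-insertAt-≢ c v w (w≢v ∘ cong suc)

neighbour-≢ : ∀ {n} (G : Graph n) v w → T (adj G v w) → ¬ w ≡ v
neighbour-≢ G v .v t refl = subst T (adj-irrefl G v) t

colours≤vertices : ∀ {n} (G : Graph n) k → HasWinningStrategy G k → k ℕ.≤ n
colours≤vertices         G zero      _         = z≤n
colours≤vertices {zero}  G (suc k-1) (s , win) with () ← proj₁ (win λ ())
colours≤vertices {suc m} G k@(suc _) (s , win) =
  ℕₚ.*-cancelʳ-≤ k (suc m) (k ℕ.^ m) ⦃ ℕₚ.m^n≢0 k m ⦄ (begin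
    k ℕ.^ suc m                       ≡⟨ sym (Σᶜ-one (suc m)) ⟩
    Σᶜ {k} {suc m} (λ _ → 1)          ≤⟨ Σᶜ-mono someone-correct ⟩
    Σᶜ (λ c → sum (λ v → correct v c)) ≡⟨ sym (Σᶜ-swap (suc m) correct) ⟩
    sum (λ v → Σᶜ (correct v))        ≤⟨ sum-mono (λ v → Σᶜ-slice v (correct v) (slice v)) ⟩
    sum {suc m} (λ _ → k ℕ.^ m)       ≡⟨ sum-const (suc m) _ ⟩
    suc m ℕ.* k ℕ.^ m                 ∎)
  where
  open ℕₚ.≤-Reasoning

  correct : Fin (suc m) → Vec (Fin k) (suc m) → ℕ
  correct v c = indicator (s v (view G (lookup c) v) ≟ᶠ lookup c v)

  someone-correct : ∀ c → 1 ℕ.≤ sum (λ v → correct v c)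
  someone-correct c = let (v , p) = win (lookup c) in
    ℕₚ.≤-trans (indicator-yes (s v (view G (lookup c) v) ≟ᶠ lookup c v) p)
               (sum-term (λ v → correct v c) v)

  slice : ∀ v c → sum (λ a → correct v (insertAt c v a)) ℕ.≤ 1
  slice v c = ℕₚ.≤-reflexive (trans (sum-cong eq) (indicator-sum guess))
    where
    guess = s v (view G (lookup (insertAt c v zero)) v)

    eq : ∀ a → correct v (insertAt c v a) ≡ indicator (guess ≟ᶠ a)
    eq a = cong₂ (λ x y → indicator (x ≟ᶠ y))
      (cong (s v) (view-cong G v (λ w t → lookup-insertAt-≢ c v w (neighbour-≢ G v w t))))
      (Vecₚ.insertAt-lookup c v a)

------------------------------------------------------------------------
-- The hat guessing number

module _ {P : Pred ℕ 0ℓ} (P? : Decidable P) where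

  -- The largest k with 1 ≤ k ≤ m and P k, or 0 if there is none.
  greatest : ℕ → ℕ
  greatest zero    = 0
  greatest (suc m) = if does (P? (suc m)) then suc m else greatest m

  greatest-holds : ∀ m → 1 ℕ.≤ greatest m → P (greatest m)
  greatest-holds (suc m) le with P? (suc m)
  ... | yes p = p
  ... | no  _ = greatest-holds m le

  greatest-max : ∀ m k → k ℕ.≤ m → P k → k ℕ.≤ greatest m
  greatest-max zero    k k≤m p = k≤m
  greatest-max (suc m) k k≤m p with P? (suc m)
  ... | yes _ = k≤m
  ... | no ¬p = greatest-max m k
                  (ℕₚ.≤-pred (ℕₚ.≤∧≢⇒< k≤m (λ { refl → ¬p p }))) p

HG : ∀ {n} → Graph n → ℕ
HG {n} G = greatest (hasWinningStrategy? G) n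

one-colour-wins : ∀ {n} ⦃ _ : NonZero n ⦄ (G : Graph n) → HasWinningStrategy G 1
one-colour-wins {suc n} G = (λ _ _ → zero) , λ c → zero , unique (c zero)
  where
  unique : (i : Fin 1) → zero ≡ i
  unique zero = refl

HG-isHatGuessingNumber : ∀ {n} ⦃ _ : NonZero n ⦄ (G : Graph n) → IsHatGuessingNumber G (HG G)
HG-isHatGuessingNumber {n} G = (1≤HG , greatest-holds _ n 1≤HG) , λ k _ → max k
  where
  max : ∀ k → HasWinningStrategy G k → k ℕ.≤ HG G
  max k w = greatest-max (hasWinningStrategy? G) n k (colours≤vertices G k w) w

  1≤HG : 1 ℕ.≤ HG G
  1≤HG = max 1 (one-colour-wins G)

------------------------------------------------------------------------
-- The random graph with edge probability 1/2

empty : Graph 0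
empty .adj        ()
empty .adj-sym    ()
empty .adj-irrefl ()

-- Adds a new vertex zero joined to the old vertices marked true.
extend : ∀ {n} → Vec Bool n → Graph n → Graph (suc n)
extend b G .adj zero    zero    = false
extend b G .adj zero    (suc v) = lookup b v
extend b G .adj (suc u) zero    = lookup b u
extend b G .adj (suc u) (suc v) = adj G u v
extend b G .adj-sym zero    zero    = refl
extend b G .adj-sym zero    (suc v) = refl
extend b G .adj-sym (suc u) zero    = refl
extend b G .adj-sym (suc u) (suc v) = adj-sym G u v
extend b G .adj-irrefl zero    = refl
extend b G .adj-irrefl (suc v) = adj-irrefl G v

bitVectors : ∀ n → List (Vec Bool n)
bitVectors zero    = [] ∷ []
bitVectors (suc n) = cartesianProductWith _∷_ (true ∷ false ∷ []) (bitVectors n)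

graphs : ∀ n → List (Graph n)
graphs zero    = empty ∷ []
graphs (suc n) = cartesianProductWith extend (bitVectors n) (graphs n)

-- graphs n lists each labelled graph exactly once: every graph occurs
-- (graphs-complete), and the length is the number of edge sets (length-graphs).
_≅_ : ∀ {n} → Rel (Graph n) 0ℓ
G ≅ H = ∀ u v → adj G u v ≡ adj H u v

bitVectors-complete : ∀ {n} (b : Vec Bool n) → Any (b ≡_) (bitVectors n)
bitVectors-complete []      = here refl
bitVectors-complete (x ∷ b) =
  Anyₚ.cartesianProductWith⁺ _∷_ (cong₂ _∷_) (bit x) (bitVectors-complete b)
  where
  bit : ∀ x → Any (x ≡_) (true ∷ false ∷ [])
  bit true  = here refl
  bit false = there (here refl)

graphs-complete : ∀ {n} (G : Graph n) → Any (G ≅_) (graphs n)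
graphs-complete {zero}  G = here λ ()
graphs-complete {suc n} G =
  Anyₚ.cartesianProductWith⁺ extend eq (bitVectors-complete b) (graphs-complete G′)
  where
  b : Vec Bool n
  b = Vec.tabulate (λ v → adj G zero (suc v))

  G′ : Graph n
  G′ .adj u v      = adj G (suc u) (suc v)
  G′ .adj-sym u v  = adj-sym G (suc u) (suc v)
  G′ .adj-irrefl v = adj-irrefl G (suc v)

  eq : ∀ {x H} → b ≡ x → G′ ≅ H → G ≅ extend x H
  eq refl iso zero    zero    = adj-irrefl G zero
  eq refl iso zero    (suc v) = sym (Vecₚ.lookup∘tabulate _ v)
  eq refl iso (suc u) zero    = trans (adj-sym G (suc u) zero) (sym (Vecₚ.lookup∘tabulate _ u))
  eq refl iso (suc u) (suc v) = iso u v

length-cartesianProductWith : ∀ {A B C : Set} (f : A → B → C) xs ys →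
  length (cartesianProductWith f xs ys) ≡ length xs ℕ.* length ys
length-cartesianProductWith f []       ys = refl
length-cartesianProductWith f (x ∷ xs) ys =
  trans (Listₚ.length-++ (List.map (f x) ys))
        (cong₂ ℕ._+_ (Listₚ.length-map (f x) ys) (length-cartesianProductWith f xs ys))

length-bitVectors : ∀ n → length (bitVectors n) ≡ 2 ℕ.^ n
length-bitVectors zero    = refl
length-bitVectors (suc n) =
  trans (length-cartesianProductWith _∷_ (true ∷ false ∷ []) (bitVectors n))
        (cong (2 ℕ.*_) (length-bitVectors n))

length-graphs : ∀ n → length (graphs n) ≡ 2 ℕ.^ (n C 2)
length-graphs zero    = refl
length-graphs (suc n) = begin
  length (graphs (suc n))                      ≡⟨ length-cartesianProductWith extend (bitVectors n) (graphs n) ⟩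
  length (bitVectors n) ℕ.* length (graphs n)  ≡⟨ cong₂ ℕ._*_ (length-bitVectors n) (length-graphs n) ⟩
  2 ℕ.^ n ℕ.* 2 ℕ.^ (n C 2)                    ≡⟨ sym (ℕₚ.^-distribˡ-+-* 2 n (n C 2)) ⟩
  2 ℕ.^ (n ℕ.+ n C 2)                          ≡⟨ cong (λ x → 2 ℕ.^ (x ℕ.+ n C 2)) (sym (nC1≡n n)) ⟩
  2 ℕ.^ (n C 1 ℕ.+ n C 2)                      ≡⟨ cong (2 ℕ.^_) (nCk+nC[k+1]≡[n+1]C[k+1] n 1) ⟩
  2 ℕ.^ (suc n C 2)                            ∎
  where open ≡-Reasoning

-- Including each of the n C 2 possible edges independently with probability
-- 1/2 gives each labelled graph on n vertices probability 1 / 2 ^ (n C 2).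
Pr : ∀ n {E : Pred (Graph n) 0ℓ} → Decidable E → ℚ
Pr n E? = (pos (length (filter E? (graphs n))) ℚ./ (2 ℕ.^ (n C 2))) ⦃ ℕₚ.m^n≢0 2 (n C 2) ⦄

------------------------------------------------------------------------
-- Limits of rational sequences

_⟶_ : (ℕ → ℚ) → ℚ → Set
f ⟶ L = ∀ ε → 0ℚ ℚ.< ε → ∃ λ N → ∀ n → N ℕ.≤ n → ℚ.∣ f n ℚ.- L ∣ ℚ.< ε

WithHighProbability : {E : ∀ n → Pred (Graph n) 0ℓ} → (∀ n → Decidable (E n)) → Set
WithHighProbability E? = (λ n → Pr n (E? n)) ⟶ 1ℚ

------------------------------------------------------------------------
-- The ordered field ℚ(√5) ⊂ ℝ

-- a +√5· b is the real number a + b√5.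
record ℚ√5 : Set where
  constructor _+√5·_
  field
    rational irrational : ℚ

infix  8 _+√5·_
infixl 7 _*_
infixl 6 _+_ _-_
infix  4 _≤_ _≤?_

fromℚ : ℚ → ℚ√5
fromℚ q = q +√5· 0ℚ

fromℕ : ℕ → ℚ√5
fromℕ n = fromℚ (pos n ℚ./ 1)

√5 : ℚ√5
√5 = 0ℚ +√5· 1ℚ

_+_ _-_ _*_ : ℚ√5 → ℚ√5 → ℚ√5
(a +√5· b) + (c +√5· d) = (a ℚ.+ c) +√5· (b ℚ.+ d)
(a +√5· b) - (c +√5· d) = (a ℚ.- c) +√5· (b ℚ.- d)
(a +√5· b) * (c +√5· d) =
  (a ℚ.* c ℚ.+ (pos 5 ℚ./ 1) ℚ.* (b ℚ.* d)) +√5· (a ℚ.* d ℚ.+ b ℚ.* c)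

√5*√5≡5 : √5 * √5 ≡ fromℕ 5
√5*√5≡5 = refl

-- a + b√5 ≥ 0 in ℝ exactly when both parts are nonnegative, or a ≥ |b|√5,
-- or b√5 ≥ |a|; the last two comparisons are between squares.
NonNegative : ℚ√5 → Set
NonNegative (a +√5· b) =
    (0ℚ ℚ.≤ a × 0ℚ ℚ.≤ b)
  ⊎ (0ℚ ℚ.≤ a × (pos 5 ℚ./ 1) ℚ.* (b ℚ.* b) ℚ.≤ a ℚ.* a)
  ⊎ (0ℚ ℚ.≤ b × a ℚ.* a ℚ.≤ (pos 5 ℚ./ 1) ℚ.* (b ℚ.* b))

nonNegative? : Decidable NonNegative
nonNegative? (a +√5· b) =
        ((0ℚ ℚₚ.≤? a) ×-dec (0ℚ ℚₚ.≤? b))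
  ⊎-dec ((0ℚ ℚₚ.≤? a) ×-dec ((pos 5 ℚ./ 1) ℚ.* (b ℚ.* b) ℚₚ.≤? a ℚ.* a))
  ⊎-dec ((0ℚ ℚₚ.≤? b) ×-dec (a ℚ.* a ℚₚ.≤? (pos 5 ℚ./ 1) ℚ.* (b ℚ.* b)))

_≤_ : Rel ℚ√5 0ℓ
x ≤ y = NonNegative (y - x)

_≤?_ : ∀ x y → Dec (x ≤ y)
x ≤? y = nonNegative? (y - x)

-- (1 + √5) / 4
[1+√5]/4 : ℚ√5
[1+√5]/4 = (fromℕ 1 + √5) * fromℚ (pos 1 ℚ./ 4)

{-# OPTIONS --safe #-}

-- The constant 4/5 < (1 + √5)/4 already works, so δ = 0 will do.  Split the vertices
-- into five consecutive blocks of size b ≈ n/5, colour uniformly at random with k ≥ 4b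
-- colours, and let p be the probability that no vertex of the first blocks is right.
-- For v in the next block, "v is right and all earlier vertices are wrong" implies
-- "v is right and the set T of correct earlier vertices lies in N(v)"; as c(v) does not
-- influence the guesses of non-neighbours of v, the latter has probability
-- P(T ⊆ N(v))/k.  If every vertex has at most 6b/11 neighbours in every later block,
-- then at most 6b/11 vertices v of the block satisfy T ⊆ N(v) unless T is empty.  So
-- p drops by at most (1/4)(p + (6/11)(1 − p)) per block, and stays positive after five
-- blocks.  The degree condition holds with high probability by Chernoff's bound.
module Submission where

import Data.Nat.Properties
open import Algebra.Properties.CommutativeMonoid.Sum Data.Nat.Properties.+-0-commutativeMonoid
  using (sum; ∑-distrib-+)
open import Data.Bool.Base using (Bool; true; false; T)
open import Data.Bool.Properties using (T?)
open import Data.Fin using (#_)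
open import Data.Fin.Base using (Fin; zero; suc; toℕ)
open import Data.Fin.Properties using (¬∀⟶∃¬) renaming (_≟_ to _≟ᶠ_; any? to anyᶠ?; all? to allᶠ?)
open import Data.Integer.Base as ℤ using () renaming (+_ to pos)
import Data.Integer.Properties as ℤₚ
open import Data.List.Base as List using (List; []; _∷_; _++_; length; filter; cartesianProductWith)
import Data.List.Properties as Listₚ
open import Data.Nat.Base as ℕ using (ℕ; zero; suc; z≤n; s≤s; NonZero)
open import Data.Nat.Combinatorics using (_C_)
open import Data.Nat.DivMod using (m*n/n≡m; /-monoˡ-≤; m/n*n≤m; m≡m%n+[m/n]*n; m%n<n)
import Data.Nat.Properties as ℕₚ
open import Data.Nat.Tactic.RingSolver using (solve-∀)
open import Data.Product.Base using (∃; _×_; _,_; proj₁)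
open import Data.Rational.Base as ℚ using (ℚ; 0ℚ; 1ℚ)
import Data.Rational.Properties as ℚₚ
open import Data.Rational.Solver using (module +-*-Solver)
import Data.Rational.Unnormalised.Base as ℚᵘ
import Data.Rational.Unnormalised.Properties as ℚᵘₚ
open import Data.Sum.Base using (_⊎_; inj₁; inj₂)
open import Data.Unit.Base using (tt)
open import Data.Vec.Base using (Vec; []; _∷_; insertAt; lookup)
import Data.Vec.Properties as Vecₚ
open import Defs
open import Function.Base using (_∘_)
open import Level using (0ℓ)
open import Relation.Binary.PropositionalEquality
open import Relation.Nullary using (Dec; yes; no; ¬_; ¬?; _×-dec_; _→-dec_; contradiction)
open import Relation.Nullary.Decidable using (decidable-stable)
open import Relation.Unary using (Pred; Decidable)

-- Indicators and sums over colourings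

indicator-no : {P : Set} (d : Dec P) → ¬ P → indicator d ≡ 0
indicator-no (yes p) ¬p = contradiction p ¬p
indicator-no (no _)  _  = refl

indicator-mono : {P Q : Set} (d : Dec P) (e : Dec Q) → (P → Q) → indicator d ℕ.≤ indicator e
indicator-mono (yes p) e f = indicator-yes e (f p)
indicator-mono (no _)  e f = z≤n

sum-zero : ∀ {n} {f : Fin n → ℕ} → (∀ i → f i ≡ 0) → sum f ≡ 0
sum-zero {n} eq = trans (sum-cong eq) (trans (sum-const n 0) (ℕₚ.*-zeroʳ n))

sum-* : ∀ n x (f : Fin n → ℕ) → sum (λ i → x ℕ.* f i) ≡ x ℕ.* sum f
sum-* zero    x f = sym (ℕₚ.*-zeroʳ x)
sum-* (suc n) x f = trans (cong (x ℕ.* f zero ℕ.+_) (sum-* n x (f ∘ suc)))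
                          (sym (ℕₚ.*-distribˡ-+ x (f zero) _))

module _ {k : ℕ} where

  Σᶜ-cong : ∀ {n} {f g : Vec (Fin k) n → ℕ} → f ≗ g → Σᶜ f ≡ Σᶜ g
  Σᶜ-cong {zero}  eq = eq []
  Σᶜ-cong {suc n} eq = sum-cong λ a → Σᶜ-cong (λ c → eq (a ∷ c))

  Σᶜ-+ : ∀ n (f g : Vec (Fin k) n → ℕ) → Σᶜ (λ c → f c ℕ.+ g c) ≡ Σᶜ f ℕ.+ Σᶜ g
  Σᶜ-+ zero    f g = refl
  Σᶜ-+ (suc n) f g = trans (sum-cong λ a → Σᶜ-+ n (λ c → f (a ∷ c)) (λ c → g (a ∷ c)))
                           (∑-distrib-+ {k} _ _)

  Σᶜ-* : ∀ n x (f : Vec (Fin k) n → ℕ) → Σᶜ (λ c → x ℕ.* f c) ≡ x ℕ.* Σᶜ f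
  Σᶜ-* zero    x f = refl
  Σᶜ-* (suc n) x f = trans (sum-cong λ a → Σᶜ-* n x (λ c → f (a ∷ c))) (sum-* k x _)

  Σᶜ-const : ∀ n x → Σᶜ {k} {n} (λ _ → x) ≡ x ℕ.* k ℕ.^ n
  Σᶜ-const n x = begin
    Σᶜ {k} {n} (λ _ → x)          ≡⟨ Σᶜ-cong {n} (λ _ → sym (ℕₚ.*-identityʳ x)) ⟩
    Σᶜ {k} {n} (λ _ → x ℕ.* 1)    ≡⟨ Σᶜ-* n x (λ _ → 1) ⟩
    x ℕ.* Σᶜ {k} {n} (λ _ → 1)    ≡⟨ cong (x ℕ.*_) (Σᶜ-one n) ⟩
    x ℕ.* k ℕ.^ n                 ∎
    where open ≡-Reasoning

  -- Fixing the other colours while that of `v` varies is how the independence of a guess from that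
  -- colour gets used.
  Σᶜ-insertAt : ∀ {m} (v : Fin (suc m)) (f : Vec (Fin k) (suc m) → ℕ) →
                Σᶜ f ≡ Σᶜ (λ c → sum (λ a → f (insertAt c v a)))
  Σᶜ-insertAt {m}     zero    f = Σᶜ-swap m (λ a c → f (a ∷ c))
  Σᶜ-insertAt {suc m} (suc v) f = sum-cong λ a → Σᶜ-insertAt v (λ c → f (a ∷ c))

-- Blocks of vertices and degrees into them

-- The number of vertices after v: it is unchanged when vertices are added in front by
-- extend, and a graph built by extend gives v one independent bit for each of them.
rev : ∀ {n} → Fin n → ℕ
rev {suc n} zero    = n
rev {suc n} (suc v) = rev v

rev<n : ∀ {n} (v : Fin n) → rev v ℕ.< n
rev<n zero    = ℕₚ.≤-refl
rev<n (suc v) = ℕₚ.m≤n⇒m≤1+n (rev<n v)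

Block : ℕ → ℕ → Pred ℕ 0ℓ
Block b t i = t ℕ.≤ i × i ℕ.< b ℕ.+ t

block? : ∀ b t → Decidable (Block b t)
block? b t i = (t ℕₚ.≤? i) ×-dec (i ℕₚ.<? (b ℕ.+ t))

-- `rev` takes each value below `n` once. The bound feeds `block-size`: there the first vertex found
-- in the block satisfies `n < b + t`, so that `suc n ∸ t` is at most `b`.
block-size≤n∸t : ∀ b t n → sum {n} (λ v → indicator (block? b t (rev v))) ℕ.≤ n ℕ.∸ t
block-size≤n∸t b t zero    = z≤n
block-size≤n∸t b t (suc n) = go (block? b t n)
  where
  go : (B : Dec (Block b t n)) →
       indicator B ℕ.+ sum {n} (λ v → indicator (block? b t (rev v))) ℕ.≤ suc n ℕ.∸ t
  go (yes (t≤n , _)) = ℕₚ.≤-trans (s≤s (block-size≤n∸t b t n))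
                                  (ℕₚ.≤-reflexive (sym (ℕₚ.+-∸-assoc 1 t≤n)))
  go (no _)          = ℕₚ.≤-trans (block-size≤n∸t b t n) (ℕₚ.∸-monoˡ-≤ t (ℕₚ.n≤1+n n))

block-size : ∀ b t n → sum {n} (λ v → indicator (block? b t (rev v))) ℕ.≤ b
block-size b t zero    = z≤n
block-size b t (suc n) = go (block? b t n) (block-size≤n∸t b t (suc n))
  where
  S = sum {n} (λ v → indicator (block? b t (rev v)))

  go : (B : Dec (Block b t n)) → indicator B ℕ.+ S ℕ.≤ suc n ℕ.∸ t → indicator B ℕ.+ S ℕ.≤ b
  go (yes (_ , n<b+t)) le =
    ℕₚ.≤-trans le (ℕₚ.≤-trans (ℕₚ.∸-monoˡ-≤ t n<b+t) (ℕₚ.≤-reflexive (ℕₚ.m+n∸n≡m b t)))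
  go (no _)            _  = block-size b t n

degreeIn : ∀ {n} {B : Pred ℕ 0ℓ} → Decidable B → Graph n → Fin n → ℕ
degreeIn B? G u = sum (λ v → indicator (T? (adj G u v) ×-dec B? (rev v)))

-- A larger `rev` means an earlier position, so only vertices before the block are constrained.
-- `extend` adds these once the block is complete, with fresh bits for their edges into it.
SparseBlock : ℕ → ℕ → ℕ → ∀ {n} → Graph n → Set
SparseBlock b d t G = ∀ u → b ℕ.+ t ℕ.≤ rev u → degreeIn (block? b t) G u ℕ.≤ d

-- Guesses that ignore the colour of a vertex

module _ {n k : ℕ} (G : Graph n) (s : Strategy G k) where

  Correct : Vec (Fin k) n → Fin n → Set
  Correct c v = GuessesCorrectly G s (lookup c) v

  correct? : ∀ c v → Dec (Correct c v)
  correct? c v = s v (view G (lookup c) v) ≟ᶠ lookup c v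

module _ {m k : ℕ} (G : Graph (suc m)) (s : Strategy G k) (v : Fin (suc m)) where

  -- The colour of `v` enters neither the view of `u` nor the colour of `u`.
  correct-insertAt : ∀ {u} → ¬ u ≡ v → ¬ T (adj G u v) → ∀ c a a′ →
                     Correct G s (insertAt c v a) u → Correct G s (insertAt c v a′) u
  correct-insertAt {u} u≢v u≁v c a a′ p = begin
    s u (view G (lookup (insertAt c v a′)) u)  ≡⟨ cong (s u) (view-cong G u (λ w u∼w →
                                                    lookup-insertAt-≢ c v w (λ { refl → u≁v u∼w }))) ⟩
    s u (view G (lookup (insertAt c v a)) u)   ≡⟨ p ⟩
    lookup (insertAt c v a) u                  ≡⟨ lookup-insertAt-≢ c v u u≢v ⟩
    lookup (insertAt c v a′) u                 ∎
    where open ≡-Reasoning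

  correct-at-most-once : ∀ c → sum (λ a → indicator (correct? G s (insertAt c v a) v)) ℕ.≤ 1
  correct-at-most-once c = go k refl
    where
    same-view : ∀ a b → view G (lookup (insertAt c v a)) v ≡ view G (lookup (insertAt c v b)) v
    same-view a b = view-cong G v (λ w v∼w → lookup-insertAt-≢ c v w (neighbour-≢ G v w v∼w))

    go : ∀ j → j ≡ k → sum (λ a → indicator (correct? G s (insertAt c v a) v)) ℕ.≤ 1
    -- With no colours the sum is empty; otherwise the colour `zero` serves to compute the one guess
    -- that `v` makes for every `a`.
    go zero    refl = z≤n
    go (suc j) refl = ℕₚ.≤-reflexive (trans
      (sum-cong (λ a → cong₂ (λ x y → indicator (x ≟ᶠ y)) (cong (s v) (same-view a zero))
                             (Vecₚ.insertAt-lookup c v a)))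
      (indicator-sum (s v (view G (lookup (insertAt c v zero)) v))))

  -- The guess of v ignores the colour of v, so it is right for one in k colours.
  correct-independent : {H : Pred (Vec (Fin k) (suc m)) 0ℓ} (H? : Decidable H) →
    (∀ c a a′ → H (insertAt c v a) → H (insertAt c v a′)) →
    k ℕ.* Σᶜ (λ c → indicator (correct? G s c v ×-dec H? c)) ℕ.≤ Σᶜ (λ c → indicator (H? c))
  correct-independent {H} H? resp = begin
    k ℕ.* Σᶜ (λ c → both c)                                ≡⟨ cong (k ℕ.*_) (Σᶜ-insertAt v both) ⟩
    k ℕ.* Σᶜ (λ c → sum λ a → both (insertAt c v a))       ≡⟨ sym (Σᶜ-* m k _) ⟩
    Σᶜ (λ c → k ℕ.* sum λ a → both (insertAt c v a))       ≤⟨ Σᶜ-mono pointwise ⟩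
    Σᶜ (λ c → sum λ a → indicator (H? (insertAt c v a)))
      ≡⟨ sym (Σᶜ-insertAt v (λ c → indicator (H? c))) ⟩
    Σᶜ (λ c → indicator (H? c))                            ∎
    where
    open ℕₚ.≤-Reasoning
    both : Vec (Fin k) (suc m) → ℕ
    both c = indicator (correct? G s c v ×-dec H? c)

    pointwise : ∀ c → k ℕ.* sum (λ a → both (insertAt c v a)) ℕ.≤
                      sum (λ a → indicator (H? (insertAt c v a)))
    -- By `resp`, `H` holds for none of the colours of `v` or for all `k` of them.
    pointwise c with anyᶠ? (λ a → H? (insertAt c v a))
    ... | no ¬h = ℕₚ.≤-trans (ℕₚ.≤-reflexive (trans (cong (k ℕ.*_) (sum-zero λ a →
                    indicator-no (correct? G s (insertAt c v a) v ×-dec H? (insertAt c v a))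
                                 (λ (_ , h) → ¬h (a , h)))) (ℕₚ.*-zeroʳ k))) z≤n
    ... | yes (a₀ , h) = begin
      k ℕ.* sum (λ a → both (insertAt c v a))
        ≤⟨ ℕₚ.*-monoʳ-≤ k (sum-mono λ a → indicator-mono
             (correct? G s (insertAt c v a) v ×-dec H? (insertAt c v a))
             (correct? G s (insertAt c v a) v) proj₁) ⟩
      k ℕ.* sum (λ a → indicator (correct? G s (insertAt c v a) v))
        ≤⟨ ℕₚ.*-monoʳ-≤ k (correct-at-most-once c) ⟩
      k ℕ.* 1
        ≡⟨ sym (sum-const k 1) ⟩
      sum {k} (λ _ → 1)
        ≤⟨ sum-mono (λ a → indicator-yes (H? (insertAt c v a)) (resp c a₀ a h)) ⟩
      sum (λ a → indicator (H? (insertAt c v a)))  ∎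

-- Silent colourings and the loss in one block

module _ {n k : ℕ} (G : Graph n) (s : Strategy G k) where

  -- The vertices with `t ≤ rev u` are those of the blocks processed so far; `t` goes down to 0 in
  -- steps of the block size.
  Loud : ℕ → Pred (Vec (Fin k) n) 0ℓ
  Loud t c = ∃ λ u → t ℕ.≤ rev u × Correct G s c u

  loud? : ∀ t → Decidable (Loud t)
  loud? t c = anyᶠ? λ u → (t ℕₚ.≤? rev u) ×-dec correct? G s c u

  -- The negation is the condition T ⊆ N(v): every correct `u` with `t ≤ rev u` is adjacent to `v`.
  LoudAwayFrom : Fin n → ℕ → Pred (Vec (Fin k) n) 0ℓ
  LoudAwayFrom v t c = ∃ λ u → (t ℕ.≤ rev u × ¬ T (adj G u v)) × Correct G s c u

  loudAwayFrom? : ∀ v t → Decidable (LoudAwayFrom v t)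
  loudAwayFrom? v t c =
    anyᶠ? λ u → ((t ℕₚ.≤? rev u) ×-dec ¬? (T? (adj G u v))) ×-dec correct? G s c u

  silentCount : ℕ → ℕ
  silentCount t = Σᶜ λ c → indicator (¬? (loud? t c))

module _ (b d t : ℕ) where

  -- A relaxation of the event "the vertices before the block are all wrong" that
  -- does not depend on the colour of v.
  Exposed : ∀ {n k} (G : Graph n) (s : Strategy G k) → Fin n → Pred (Vec (Fin k) n) 0ℓ
  Exposed G s v c = Block b t (rev v) × ¬ LoudAwayFrom G s v (b ℕ.+ t) c

  exposed? : ∀ {n k} (G : Graph n) (s : Strategy G k) v → Decidable (Exposed G s v)
  exposed? G s v c = block? b t (rev v) ×-dec ¬? (loudAwayFrom? G s v (b ℕ.+ t) c)

  -- The vertices that enter the condition precede the block, hence differ from `v`, and are not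
  -- adjacent to `v`. So exposure does not change with the colour of `v`.
  exposed-correct : ∀ {n k} (G : Graph n) (s : Strategy G k) v →
    k ℕ.* Σᶜ (λ c → indicator (correct? G s c v ×-dec exposed? G s v c)) ℕ.≤
    Σᶜ (λ c → indicator (exposed? G s v c))
  exposed-correct {suc m} G s v = correct-independent G s v (exposed? G s v)
    λ c a a′ ((t≤v , v<b+t) , quiet) → (t≤v , v<b+t) ,
      λ { (u , (le , u≁v) , p) → quiet (u , (le , u≁v) ,
        correct-insertAt G s v (λ { refl → ℕₚ.<⇒≱ v<b+t le }) u≁v c a′ a p) }

  module _ {n k : ℕ} (G : Graph n) (s : Strategy G k) where
    private
      silent : ℕ → Vec (Fin k) n → ℕ
      silent t c = indicator (¬? (loud? G s t c))

      hit : Fin n → Vec (Fin k) n → ℕ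
      hit v c = indicator (correct? G s c v ×-dec exposed? G s v c)

      exposed : Fin n → Vec (Fin k) n → ℕ
      exposed v c = indicator (exposed? G s v c)

    -- If nobody before the block is right but some `v` with `t ≤ rev v` is, then `v` lies in the
    -- block, and it is exposed because the set of correct earlier vertices is empty.
    silent-split : ∀ c → silent (b ℕ.+ t) c ℕ.≤ silent t c ℕ.+ sum (λ v → hit v c)
    silent-split c = go (loud? G s (b ℕ.+ t) c) (loud? G s t c)
      where
      go : (l′ : Dec (Loud G s (b ℕ.+ t) c)) (l : Dec (Loud G s t c)) →
           indicator (¬? l′) ℕ.≤ indicator (¬? l) ℕ.+ sum (λ v → hit v c)
      go (yes _) _                   = z≤n
      go (no _)  (no _)              = s≤s z≤n
      go (no ¬l) (yes (v , t≤v , p)) =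
        ℕₚ.≤-trans (indicator-yes (correct? G s c v ×-dec exposed? G s v c)
                     (p , (t≤v , ℕₚ.≰⇒> (λ le → ¬l (v , le , p)))
                        , λ { (u , (le , _) , q) → ¬l (u , le , q) }))
                   (sum-term (λ v → hit v c) v)

    -- If the set of correct vertices before the block is nonempty, it must lie
    -- inside the neighbourhood of an exposed v, so that one of its members bounds
    -- the number of such v by its degree into the block.
    exposed-few : SparseBlock b d t G → ∀ c →
      sum (λ v → exposed v c) ℕ.+ d ℕ.* silent (b ℕ.+ t) c ℕ.≤ b ℕ.* silent (b ℕ.+ t) c ℕ.+ d
    exposed-few sparse c = go (loud? G s (b ℕ.+ t) c)
      where
      open ℕₚ.≤-Reasoning
      go : (l : Dec (Loud G s (b ℕ.+ t) c)) →
           sum (λ v → exposed v c) ℕ.+ d ℕ.* indicator (¬? l) ℕ.≤ b ℕ.* indicator (¬? l) ℕ.+ d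
      go (no _) = begin
        sum (λ v → exposed v c) ℕ.+ d ℕ.* 1
          ≡⟨ cong (sum (λ v → exposed v c) ℕ.+_) (ℕₚ.*-identityʳ d) ⟩
        sum (λ v → exposed v c) ℕ.+ d
          ≤⟨ ℕₚ.+-monoˡ-≤ d (sum-mono λ v →
               indicator-mono (exposed? G s v c) (block? b t (rev v)) proj₁) ⟩
        sum {n} (λ v → indicator (block? b t (rev v))) ℕ.+ d
          ≤⟨ ℕₚ.+-monoˡ-≤ d (block-size b t n) ⟩
        b ℕ.+ d
          ≡⟨ cong (ℕ._+ d) (sym (ℕₚ.*-identityʳ b)) ⟩
        b ℕ.* 1 ℕ.+ d ∎
      go (yes (u , le , p)) = begin
        sum (λ v → exposed v c) ℕ.+ d ℕ.* 0
          ≡⟨ trans (cong (sum (λ v → exposed v c) ℕ.+_) (ℕₚ.*-zeroʳ d)) (ℕₚ.+-identityʳ _) ⟩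
        sum (λ v → exposed v c)
          ≤⟨ sum-mono (λ v → indicator-mono (exposed? G s v c)
               (T? (adj G u v) ×-dec block? b t (rev v)) (λ (B , quiet) →
                 decidable-stable (T? (adj G u v)) (λ u≁v → quiet (u , (le , u≁v) , p)) , B)) ⟩
        degreeIn (block? b t) G u
          ≤⟨ sparse u le ⟩
        d
          ≤⟨ ℕₚ.m≤n+m d (b ℕ.* 0) ⟩
        b ℕ.* 0 ℕ.+ d ∎

    -- Summing `silent-split`, trading hits for exposures at the rate 1/k and bounding these by
    -- `exposed-few` gives p′ - p ≤ (b p′ + d (1 - p′)) / k for the silent proportions p′ at `b + t`
    -- and p at `t`. Terms are moved to avoid subtraction.
    silentCount-block : SparseBlock b d t G →
      k ℕ.* silentCount G s (b ℕ.+ t) ℕ.+ d ℕ.* silentCount G s (b ℕ.+ t) ℕ.≤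
      k ℕ.* silentCount G s t ℕ.+ (b ℕ.* silentCount G s (b ℕ.+ t) ℕ.+ d ℕ.* k ℕ.^ n)
    silentCount-block sparse = begin
      k ℕ.* S′ ℕ.+ d ℕ.* S′
        ≤⟨ ℕₚ.+-monoˡ-≤ (d ℕ.* S′) (ℕₚ.*-monoʳ-≤ k (ℕₚ.≤-trans (Σᶜ-mono silent-split)
             (ℕₚ.≤-reflexive (Σᶜ-+ n (silent t) _)))) ⟩
      k ℕ.* (S ℕ.+ Σᶜ (λ c → sum (λ v → hit v c))) ℕ.+ d ℕ.* S′
        ≡⟨ trans (cong (ℕ._+ d ℕ.* S′) (ℕₚ.*-distribˡ-+ k S _)) (ℕₚ.+-assoc (k ℕ.* S) _ _) ⟩
      k ℕ.* S ℕ.+ (k ℕ.* Σᶜ (λ c → sum (λ v → hit v c)) ℕ.+ d ℕ.* S′)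
        ≤⟨ ℕₚ.+-monoʳ-≤ (k ℕ.* S) (ℕₚ.≤-trans (ℕₚ.+-monoˡ-≤ (d ℕ.* S′) hits) exposures) ⟩
      k ℕ.* S ℕ.+ (b ℕ.* S′ ℕ.+ d ℕ.* k ℕ.^ n) ∎
      where
      open ℕₚ.≤-Reasoning
      S  = silentCount G s t
      S′ = silentCount G s (b ℕ.+ t)

      hits : k ℕ.* Σᶜ (λ c → sum (λ v → hit v c)) ℕ.≤ Σᶜ (λ c → sum (λ v → exposed v c))
      hits = begin
        k ℕ.* Σᶜ (λ c → sum (λ v → hit v c))  ≡⟨ cong (k ℕ.*_) (sym (Σᶜ-swap n hit)) ⟩
        k ℕ.* sum (λ v → Σᶜ (hit v))          ≡⟨ sym (sum-* n k _) ⟩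
        sum (λ v → k ℕ.* Σᶜ (hit v))          ≤⟨ sum-mono (exposed-correct G s) ⟩
        sum (λ v → Σᶜ (exposed v))            ≡⟨ Σᶜ-swap n exposed ⟩
        Σᶜ (λ c → sum (λ v → exposed v c))    ∎

      exposures : Σᶜ (λ c → sum (λ v → exposed v c)) ℕ.+ d ℕ.* S′ ℕ.≤ b ℕ.* S′ ℕ.+ d ℕ.* k ℕ.^ n
      exposures = begin
        Σᶜ (λ c → sum (λ v → exposed v c)) ℕ.+ d ℕ.* S′
          ≡⟨ trans (cong (Σᶜ (λ c → sum (λ v → exposed v c)) ℕ.+_) (sym (Σᶜ-* n d _)))
                   (sym (Σᶜ-+ n _ _)) ⟩
        Σᶜ (λ c → sum (λ v → exposed v c) ℕ.+ d ℕ.* silent (b ℕ.+ t) c)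
          ≤⟨ Σᶜ-mono (exposed-few sparse) ⟩
        Σᶜ (λ c → b ℕ.* silent (b ℕ.+ t) c ℕ.+ d)
          ≡⟨ trans (Σᶜ-+ n (λ c → b ℕ.* silent (b ℕ.+ t) c) _)
                   (cong₂ ℕ._+_ (Σᶜ-* n b (silent (b ℕ.+ t))) (Σᶜ-const n d)) ⟩
        b ℕ.* S′ ℕ.+ d ℕ.* k ℕ.^ n ∎

-- Five blocks

-- silentCount-block with b = 11m, d = 6m and k ≥ 4b.
block-contraction : ∀ m k S S′ N → 1 ℕ.≤ k → 44 ℕ.* m ℕ.≤ k →
  k ℕ.* S′ ℕ.+ 6 ℕ.* m ℕ.* S′ ℕ.≤ k ℕ.* S ℕ.+ (11 ℕ.* m ℕ.* S′ ℕ.+ 6 ℕ.* m ℕ.* N) →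
  39 ℕ.* S′ ℕ.≤ 44 ℕ.* S ℕ.+ 6 ℕ.* N
block-contraction m k@(suc _) S S′ N _ 44m≤k le =
  -- After multiplication by 44, the 6 m S′ on the left absorbs part of the 11 m S′ on the right.
  -- What remains is 44 m (5 S′ + 6 N), where `44m≤k` applies; then 39 = 44 - 5.
  ℕₚ.*-cancelˡ-≤ k (ℕₚ.+-cancelʳ-≤ (5 ℕ.* (k ℕ.* S′) ℕ.+ 264 ℕ.* (m ℕ.* S′)) _ _ (begin
    k ℕ.* (39 ℕ.* S′) ℕ.+ (5 ℕ.* (k ℕ.* S′) ℕ.+ 264 ℕ.* (m ℕ.* S′))
      ≡⟨ left k m S′ ⟩
    44 ℕ.* (k ℕ.* S′ ℕ.+ 6 ℕ.* m ℕ.* S′)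
      ≤⟨ ℕₚ.*-monoʳ-≤ 44 le ⟩
    44 ℕ.* (k ℕ.* S ℕ.+ (11 ℕ.* m ℕ.* S′ ℕ.+ 6 ℕ.* m ℕ.* N))
      ≡⟨ right k m S S′ N ⟩
    44 ℕ.* (k ℕ.* S) ℕ.+ (264 ℕ.* (m ℕ.* S′) ℕ.+ 44 ℕ.* m ℕ.* (5 ℕ.* S′ ℕ.+ 6 ℕ.* N))
      ≤⟨ ℕₚ.+-monoʳ-≤ (44 ℕ.* (k ℕ.* S)) (ℕₚ.+-monoʳ-≤ (264 ℕ.* (m ℕ.* S′))
           (ℕₚ.*-monoˡ-≤ (5 ℕ.* S′ ℕ.+ 6 ℕ.* N) 44m≤k)) ⟩
    44 ℕ.* (k ℕ.* S) ℕ.+ (264 ℕ.* (m ℕ.* S′) ℕ.+ k ℕ.* (5 ℕ.* S′ ℕ.+ 6 ℕ.* N))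
      ≡⟨ final k m S S′ N ⟩
    k ℕ.* (44 ℕ.* S ℕ.+ 6 ℕ.* N) ℕ.+ (5 ℕ.* (k ℕ.* S′) ℕ.+ 264 ℕ.* (m ℕ.* S′)) ∎))
  where
  open ℕₚ.≤-Reasoning
  left : ∀ k m S′ → k ℕ.* (39 ℕ.* S′) ℕ.+ (5 ℕ.* (k ℕ.* S′) ℕ.+ 264 ℕ.* (m ℕ.* S′)) ≡
                    44 ℕ.* (k ℕ.* S′ ℕ.+ 6 ℕ.* m ℕ.* S′)
  left = solve-∀

  right : ∀ k m S S′ N → 44 ℕ.* (k ℕ.* S ℕ.+ (11 ℕ.* m ℕ.* S′ ℕ.+ 6 ℕ.* m ℕ.* N)) ≡
    44 ℕ.* (k ℕ.* S) ℕ.+ (264 ℕ.* (m ℕ.* S′) ℕ.+ 44 ℕ.* m ℕ.* (5 ℕ.* S′ ℕ.+ 6 ℕ.* N))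
  right = solve-∀

  final : ∀ k m S S′ N →
    44 ℕ.* (k ℕ.* S) ℕ.+ (264 ℕ.* (m ℕ.* S′) ℕ.+ k ℕ.* (5 ℕ.* S′ ℕ.+ 6 ℕ.* N)) ≡
    k ℕ.* (44 ℕ.* S ℕ.+ 6 ℕ.* N) ℕ.+ (5 ℕ.* (k ℕ.* S′) ℕ.+ 264 ℕ.* (m ℕ.* S′))
  final = solve-∀

-- The literals are right factors: as left factors they would be unfolded in unary.
contract-fraction : ∀ α β γ {S S′ N} → γ ℕ.+ 6 ℕ.* β ≡ 39 ℕ.* α →
  39 ℕ.* S′ ℕ.≤ 44 ℕ.* S ℕ.+ 6 ℕ.* N → N ℕ.* α ℕ.≤ S′ ℕ.* β → N ℕ.* γ ℕ.≤ S ℕ.* (44 ℕ.* β)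
-- In fractions: S/N ≥ (39 α/β - 6)/44 = γ/(44 β). The summand 6 β N on both sides avoids
-- subtraction.
contract-fraction α β γ {S} {S′} {N} eq step le = ℕₚ.+-cancelʳ-≤ (N ℕ.* (6 ℕ.* β)) _ _ (begin
  N ℕ.* γ ℕ.+ N ℕ.* (6 ℕ.* β)          ≡⟨ sym (ℕₚ.*-distribˡ-+ N γ (6 ℕ.* β)) ⟩
  N ℕ.* (γ ℕ.+ 6 ℕ.* β)                ≡⟨ trans (cong (N ℕ.*_) eq) (swap N α) ⟩
  39 ℕ.* (N ℕ.* α)                     ≤⟨ ℕₚ.*-monoʳ-≤ 39 le ⟩
  39 ℕ.* (S′ ℕ.* β)                    ≡⟨ sym (ℕₚ.*-assoc 39 S′ β) ⟩
  39 ℕ.* S′ ℕ.* β                      ≤⟨ ℕₚ.*-monoˡ-≤ β step ⟩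
  (44 ℕ.* S ℕ.+ 6 ℕ.* N) ℕ.* β         ≡⟨ expand β S N ⟩
  S ℕ.* (44 ℕ.* β) ℕ.+ N ℕ.* (6 ℕ.* β) ∎)
  where
  open ℕₚ.≤-Reasoning
  swap : ∀ N α → N ℕ.* (39 ℕ.* α) ≡ 39 ℕ.* (N ℕ.* α)
  swap = solve-∀

  expand : ∀ β S N → (44 ℕ.* S ℕ.+ 6 ℕ.* N) ℕ.* β ≡ S ℕ.* (44 ℕ.* β) ℕ.+ N ℕ.* (6 ℕ.* β)
  expand = solve-∀

-- Block `j` has `rev` in [jb, (j+1)b) with b = 11m, so the five cover all vertices once n ≤ 55m.
-- The share 6/11 exceeds the mean 1/2, which leaves room for Chernoff's bound.
Balanced : ℕ → ∀ {n} → Graph n → Set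
Balanced m G = ∀ (j : Fin 5) → SparseBlock (11 ℕ.* m) (6 ℕ.* m) (toℕ j ℕ.* (11 ℕ.* m)) G

module _ {n k : ℕ} (G : Graph n) (s : Strategy G k) where

  silentCount-all : ∀ t → n ℕ.≤ t → k ℕ.^ n ℕ.≤ silentCount G s t
  silentCount-all t n≤t = ℕₚ.≤-trans (ℕₚ.≤-reflexive (sym (Σᶜ-one n)))
    (Σᶜ-mono λ c → indicator-yes (¬? (loud? G s t c))
      (λ (u , t≤u , _) → ℕₚ.<⇒≱ (rev<n u) (ℕₚ.≤-trans n≤t t≤u)))

  winning⇒silentCount≡0 : Winning G s → silentCount G s 0 ≡ 0
  winning⇒silentCount≡0 win = trans
    (Σᶜ-cong {n = n} λ c → indicator-no (¬? (loud? G s 0 c))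
      (λ quiet → let (v , p) = win (lookup c) in quiet (v , z≤n , p)))
    (Σᶜ-const n 0)

-- The proportions 1, 33/44, 1023/1936, … of silent colourings come from iterating
-- x ↦ (39 x − 6) / 44; the fifth iterate is still positive.
balanced⇒no-winning : ∀ {n k} m (G : Graph n) → 1 ℕ.≤ k → n ℕ.≤ 55 ℕ.* m → 44 ℕ.* m ℕ.≤ k →
                      Balanced m G → ¬ HasWinningStrategy G k
balanced⇒no-winning {n} {k@(suc _)} m G 1≤k n≤55m 44m≤k balanced (s , win) =
  -- Without a silent colouring, `stage₅` would force `k ^ n` times a positive number to be at most
  -- 0.
  ℕₚ.<⇒≱ (ℕₚ.m^n>0 k n) (ℕₚ.≤-trans (ℕₚ.m≤m*n (k ℕ.^ n) 593769)
    (subst (λ S₀ → k ℕ.^ n ℕ.* 593769 ℕ.≤ S₀ ℕ.* 164916224) (winning⇒silentCount≡0 G s win) stage₅))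
  where
  b = 11 ℕ.* m
  S : ℕ → ℕ
  S j = silentCount G s (j ℕ.* b)

  step : (j : Fin 5) → 39 ℕ.* S (suc (toℕ j)) ℕ.≤ 44 ℕ.* S (toℕ j) ℕ.+ 6 ℕ.* k ℕ.^ n
  step j = block-contraction m k (S (toℕ j)) (S (suc (toℕ j))) (k ℕ.^ n) 1≤k 44m≤k
             (silentCount-block b (6 ℕ.* m) (toℕ j ℕ.* b) G s (balanced j))

  advance : (j : Fin 5) → ∀ α β γ → γ ℕ.+ 6 ℕ.* β ≡ 39 ℕ.* α →
            k ℕ.^ n ℕ.* α ℕ.≤ S (suc (toℕ j)) ℕ.* β → k ℕ.^ n ℕ.* γ ℕ.≤ S (toℕ j) ℕ.* (44 ℕ.* β)
  advance j α β γ eq = contract-fraction α β γ {S (toℕ j)} {S (suc (toℕ j))} {k ℕ.^ n} eq (step j)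

  stage₅ : k ℕ.^ n ℕ.* 593769 ℕ.≤ S 0 ℕ.* 164916224
  -- To be read from the inside: at `5 b ≥ n` all colourings are silent, and each block multiplies
  -- the denominator by 44.
  stage₅ = advance (# 0) 591855 3748096 593769 refl
         ( advance (# 1) 28281 85184 591855 refl
         ( advance (# 2) 1023 1936 28281 refl
         ( advance (# 3) 33 44 1023 refl
         ( advance (# 4) 1 1 33 refl
         ( ℕₚ.*-monoˡ-≤ 1 (silentCount-all G s (5 ℕ.* b)
             (ℕₚ.≤-trans n≤55m (ℕₚ.≤-reflexive (ℕₚ.*-assoc 5 11 m)))))))))

-- Counting graphs with unbalanced degrees

count : {A : Set} {P : Pred A 0ℓ} → Decidable P → List A → ℕ
count P? xs = length (filter P? xs)

module _ {A : Set} {P : Pred A 0ℓ} (P? : Decidable P) where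

  count-∷ : ∀ x xs → count P? (x ∷ xs) ≡ indicator (P? x) ℕ.+ count P? xs
  count-∷ x xs with P? x
  ... | yes _ = refl
  ... | no  _ = refl

  count-++ : ∀ xs ys → count P? (xs ++ ys) ≡ count P? xs ℕ.+ count P? ys
  count-++ xs ys = trans (cong length (Listₚ.filter-++ P? xs ys)) (Listₚ.length-++ (filter P? xs))

  count-complement : ∀ xs → count P? xs ℕ.+ count (¬? ∘ P?) xs ≡ length xs
  count-complement []       = refl
  count-complement (x ∷ xs) with P? x
  ... | yes _ = cong suc (count-complement xs)
  ... | no  _ = trans (ℕₚ.+-suc _ _) (cong suc (count-complement xs))

module _ {A B : Set} {P : Pred B 0ℓ} {Q : Pred A 0ℓ} (P? : Decidable P) (Q? : Decidable Q) where

  count-map-≤ : (f : A → B) → (∀ x → P (f x) → Q x) →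
                ∀ xs → count P? (List.map f xs) ℕ.≤ count Q? xs
  count-map-≤ f imp []       = z≤n
  count-map-≤ f imp (x ∷ xs) = begin
    count P? (f x ∷ List.map f xs)
      ≡⟨ count-∷ P? (f x) _ ⟩
    indicator (P? (f x)) ℕ.+ count P? (List.map f xs)
      ≤⟨ ℕₚ.+-mono-≤ (indicator-mono (P? (f x)) (Q? x) (imp x)) (count-map-≤ f imp xs) ⟩
    indicator (Q? x) ℕ.+ count Q? xs
      ≡⟨ sym (count-∷ Q? x xs) ⟩
    count Q? (x ∷ xs) ∎
    where open ℕₚ.≤-Reasoning

count-mono : {A : Set} {P Q : Pred A 0ℓ} (P? : Decidable P) (Q? : Decidable Q) →
             (∀ x → P x → Q x) → ∀ xs → count P? xs ℕ.≤ count Q? xs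
count-mono P? Q? imp xs =
  subst (λ ys → count P? ys ℕ.≤ count Q? xs) (Listₚ.map-id xs) (count-map-≤ P? Q? (λ x → x) imp xs)

module _ {A B D : Set} {P : Pred D 0ℓ} {Q : Pred A 0ℓ} {R : Pred B 0ℓ}
         (P? : Decidable P) (Q? : Decidable Q) (R? : Decidable R) where

  -- Rows with `Q x` are counted in full; in any other row `R y` must hold.
  count-cartesianProductWith : (f : A → B → D) → (∀ x y → P (f x y) → Q x ⊎ R y) → ∀ xs ys →
    count P? (cartesianProductWith f xs ys) ℕ.≤
    count Q? xs ℕ.* length ys ℕ.+ length xs ℕ.* count R? ys
  count-cartesianProductWith f split []       ys = z≤n
  count-cartesianProductWith f split (x ∷ xs) ys = begin
    count P? (List.map (f x) ys ++ rest)
      ≡⟨ count-++ P? (List.map (f x) ys) rest ⟩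
    count P? (List.map (f x) ys) ℕ.+ count P? rest
      ≤⟨ ℕₚ.+-mono-≤ (row (Q? x)) (count-cartesianProductWith f split xs ys) ⟩
    (indicator (Q? x) ℕ.* length ys ℕ.+ count R? ys) ℕ.+
    (count Q? xs ℕ.* length ys ℕ.+ length xs ℕ.* count R? ys)
      ≡⟨ regroup (indicator (Q? x)) (count Q? xs) (length ys) (count R? ys) (length xs) ⟩
    (indicator (Q? x) ℕ.+ count Q? xs) ℕ.* length ys ℕ.+ suc (length xs) ℕ.* count R? ys
      ≡⟨ cong (λ c → c ℕ.* length ys ℕ.+ suc (length xs) ℕ.* count R? ys) (sym (count-∷ Q? x xs)) ⟩
    count Q? (x ∷ xs) ℕ.* length ys ℕ.+ suc (length xs) ℕ.* count R? ys ∎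
    where
    open ℕₚ.≤-Reasoning
    rest = cartesianProductWith f xs ys

    regroup : ∀ q c l r n → (q ℕ.* l ℕ.+ r) ℕ.+ (c ℕ.* l ℕ.+ n ℕ.* r) ≡
                            (q ℕ.+ c) ℕ.* l ℕ.+ (1 ℕ.+ n) ℕ.* r
    regroup = solve-∀

    row : (q : Dec (Q x)) →
          count P? (List.map (f x) ys) ℕ.≤ indicator q ℕ.* length ys ℕ.+ count R? ys
    row (yes _) = begin
      count P? (List.map (f x) ys)        ≤⟨ Listₚ.length-filter P? (List.map (f x) ys) ⟩
      length (List.map (f x) ys)          ≡⟨ Listₚ.length-map (f x) ys ⟩
      length ys                           ≡⟨ sym (ℕₚ.*-identityˡ _) ⟩
      1 ℕ.* length ys                     ≤⟨ ℕₚ.m≤m+n _ _ ⟩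
      1 ℕ.* length ys ℕ.+ count R? ys     ∎
    row (no ¬q) = count-map-≤ P? R? (f x) (λ y p → resolve (split x y p)) ys
      where
      resolve : ∀ {y} → Q x ⊎ R y → R y
      resolve (inj₁ q) = contradiction q ¬q
      resolve (inj₂ r) = r

-- A union bound over the `l` conditions.
count-¬∀ : {A : Set} {l : ℕ} {P : Fin l → Pred A 0ℓ} (P? : ∀ j → Decidable (P j)) → ∀ xs →
           count (λ x → ¬? (allᶠ? λ j → P? j x)) xs ℕ.≤ sum (λ j → count (¬? ∘ P? j) xs)
count-¬∀ P? []       = z≤n
count-¬∀ {l = l} {P} P? (x ∷ xs) = begin
  count (λ x → ¬? (allᶠ? λ j → P? j x)) (x ∷ xs)
    ≡⟨ count-∷ (λ x → ¬? (allᶠ? λ j → P? j x)) x xs ⟩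
  indicator (¬? (allᶠ? λ j → P? j x)) ℕ.+ count (λ x → ¬? (allᶠ? λ j → P? j x)) xs
    ≤⟨ ℕₚ.+-mono-≤ (head (allᶠ? λ j → P? j x)) (count-¬∀ P? xs) ⟩
  sum (λ j → indicator (¬? (P? j x))) ℕ.+ sum (λ j → count (¬? ∘ P? j) xs)
    ≡⟨ sym (∑-distrib-+ {l} _ _) ⟩
  sum (λ j → indicator (¬? (P? j x)) ℕ.+ count (¬? ∘ P? j) xs)
    ≡⟨ sum-cong (λ j → sym (count-∷ (¬? ∘ P? j) x xs)) ⟩
  sum (λ j → count (¬? ∘ P? j) (x ∷ xs)) ∎
  where
  open ℕₚ.≤-Reasoning
  head : (d : Dec (∀ j → P j x)) → indicator (¬? d) ℕ.≤ sum (λ j → indicator (¬? (P? j x)))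
  head (yes _)  = z≤n
  head (no ¬∀P) = let (j , ¬Pj) = ¬∀⟶∃¬ l (λ j → P j x) (λ j → P? j x) ¬∀P in
    ℕₚ.≤-trans (indicator-yes (¬? (P? j x)) ¬Pj) (sum-term (λ j → indicator (¬? (P? j x))) j)

-- Chernoff's bound for bit vectors

module _ {B : Pred ℕ 0ℓ} (B? : Decidable B) where

  size : ℕ → ℕ
  size n = sum {n} (λ v → indicator (B? (rev v)))

  -- The degree into `B` of the vertex that `extend x` puts in front.
  ones : ∀ {n} → Vec Bool n → ℕ
  ones x = sum (λ v → indicator (T? (lookup x v) ×-dec B? (rev v)))

  manyOnes : ℕ → ℕ → ℕ
  manyOnes n t = count (λ x → t ℕₚ.≤? ones x) (bitVectors n)

  -- The Chernoff bound P (ones ≥ t) ≤ (11/10)^c / (6/5)^t, from E (6/5)^bit = 11/10.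
  ones-tail : ∀ n t c → size n ℕ.≤ c →
              manyOnes n t ℕ.* (6 ℕ.^ t ℕ.* 10 ℕ.^ c) ℕ.≤ 5 ℕ.^ t ℕ.* 11 ℕ.^ c ℕ.* 2 ℕ.^ n
  -- The tail condition is void here, and 10^c ≤ 11^c suffices.
  ones-tail n zero c _ = begin
    manyOnes n 0 ℕ.* (1 ℕ.* 10 ℕ.^ c)
      ≤⟨ ℕₚ.*-mono-≤ (Listₚ.length-filter (λ x → 0 ℕₚ.≤? ones x) (bitVectors n))
                     (ℕₚ.*-monoʳ-≤ 1 (ℕₚ.^-monoˡ-≤ c (ℕₚ.n≤1+n 10))) ⟩
    length (bitVectors n) ℕ.* (1 ℕ.* 11 ℕ.^ c)
      ≡⟨ trans (cong (ℕ._* (1 ℕ.* 11 ℕ.^ c)) (length-bitVectors n)) (ℕₚ.*-comm (2 ℕ.^ n) _) ⟩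
    1 ℕ.* 11 ℕ.^ c ℕ.* 2 ℕ.^ n ∎
    where open ℕₚ.≤-Reasoning
  ones-tail zero    (suc t) c _  = z≤n
  ones-tail (suc n) (suc t) c le =
    ℕₚ.≤-trans (ℕₚ.*-monoˡ-≤ (6 ℕ.^ suc t ℕ.* 10 ℕ.^ c) split) (bound (B? n) c le)
    where
    open ℕₚ.≤-Reasoning
    tail-count : Dec (B n) → ℕ
    tail-count d = count (λ x → suc t ℕₚ.≤? (indicator d ℕ.+ ones x)) (bitVectors n)

    split : manyOnes (suc n) (suc t) ℕ.≤ tail-count (B? n) ℕ.+ manyOnes n (suc t)
    split = begin
      manyOnes (suc n) (suc t)
        ≡⟨ trans (count-++ P? (List.map (true ∷_) (bitVectors n)) _)
                 (cong (count P? (List.map (true ∷_) (bitVectors n)) ℕ.+_)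
                       (cong (count P?) (Listₚ.++-identityʳ (List.map (false ∷_) (bitVectors n))))) ⟩
      count P? (List.map (true ∷_) (bitVectors n)) ℕ.+ count P? (List.map (false ∷_) (bitVectors n))
        ≤⟨ ℕₚ.+-mono-≤ (count-map-≤ P? (λ x → suc t ℕₚ.≤? (indicator (B? n) ℕ.+ ones x))
                                    (true ∷_) (λ _ p → p) (bitVectors n))
                       (count-map-≤ P? (λ x → suc t ℕₚ.≤? ones x) (false ∷_) (λ _ p → p) (bitVectors n)) ⟩
      tail-count (B? n) ℕ.+ manyOnes n (suc t) ∎
      where
      P? = λ (x : Vec Bool (suc n)) → suc t ℕₚ.≤? ones x

    -- A bit in `B`: 60 + 50 = 110 = 5 · 11 · 2 is the expectation (6/5 + 1)/2 = 11/10 cleared of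
    -- denominators.
    inside : ∀ A E a e X Y Z → A ℕ.* (a ℕ.* e) ℕ.≤ X ℕ.* Y ℕ.* Z →
             E ℕ.* (6 ℕ.* a ℕ.* e) ℕ.≤ 5 ℕ.* X ℕ.* Y ℕ.* Z →
             (A ℕ.+ E) ℕ.* (6 ℕ.* a ℕ.* (10 ℕ.* e)) ℕ.≤ 5 ℕ.* X ℕ.* (11 ℕ.* Y) ℕ.* (2 ℕ.* Z)
    inside A E a e X Y Z leA leC = begin
      (A ℕ.+ E) ℕ.* (6 ℕ.* a ℕ.* (10 ℕ.* e))
        ≡⟨ lhs A E a e ⟩
      60 ℕ.* (A ℕ.* (a ℕ.* e)) ℕ.+ 10 ℕ.* (E ℕ.* (6 ℕ.* a ℕ.* e))
        ≤⟨ ℕₚ.+-mono-≤ (ℕₚ.*-monoʳ-≤ 60 leA) (ℕₚ.*-monoʳ-≤ 10 leC) ⟩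
      60 ℕ.* (X ℕ.* Y ℕ.* Z) ℕ.+ 10 ℕ.* (5 ℕ.* X ℕ.* Y ℕ.* Z)
        ≡⟨ rhs X Y Z ⟩
      5 ℕ.* X ℕ.* (11 ℕ.* Y) ℕ.* (2 ℕ.* Z) ∎
      where
      lhs : ∀ A E a e → (A ℕ.+ E) ℕ.* (6 ℕ.* a ℕ.* (10 ℕ.* e)) ≡
                        60 ℕ.* (A ℕ.* (a ℕ.* e)) ℕ.+ 10 ℕ.* (E ℕ.* (6 ℕ.* a ℕ.* e))
      lhs = solve-∀

      rhs : ∀ X Y Z → 60 ℕ.* (X ℕ.* Y ℕ.* Z) ℕ.+ 10 ℕ.* (5 ℕ.* X ℕ.* Y ℕ.* Z) ≡
                      5 ℕ.* X ℕ.* (11 ℕ.* Y) ℕ.* (2 ℕ.* Z)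
      rhs = solve-∀

    -- A bit outside `B` does not change the number of ones, so both of its values give the same
    -- bound.
    outside : ∀ A E w X Z → A ℕ.* w ℕ.≤ X ℕ.* Z → E ℕ.* w ℕ.≤ X ℕ.* Z →
              (A ℕ.+ E) ℕ.* w ℕ.≤ X ℕ.* (2 ℕ.* Z)
    outside A E w X Z leA leC = begin
      (A ℕ.+ E) ℕ.* w               ≡⟨ ℕₚ.*-distribʳ-+ w A E ⟩
      A ℕ.* w ℕ.+ E ℕ.* w           ≤⟨ ℕₚ.+-mono-≤ leA leC ⟩
      X ℕ.* Z ℕ.+ X ℕ.* Z           ≡⟨ rhs X Z ⟩
      X ℕ.* (2 ℕ.* Z)               ∎
      where
      rhs : ∀ X Z → X ℕ.* Z ℕ.+ X ℕ.* Z ≡ X ℕ.* (2 ℕ.* Z)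
      rhs = solve-∀

    bound : (d : Dec (B n)) → ∀ c → indicator d ℕ.+ size n ℕ.≤ c →
            (tail-count d ℕ.+ manyOnes n (suc t)) ℕ.* (6 ℕ.^ suc t ℕ.* 10 ℕ.^ c) ℕ.≤
            5 ℕ.^ suc t ℕ.* 11 ℕ.^ c ℕ.* 2 ℕ.^ suc n
    bound d@(yes _) (suc c) (s≤s le) =
      inside (tail-count d) (manyOnes n (suc t)) (6 ℕ.^ t) (10 ℕ.^ c) (5 ℕ.^ t) (11 ℕ.^ c) (2 ℕ.^ n)
        (ℕₚ.≤-trans (ℕₚ.*-monoˡ-≤ (6 ℕ.^ t ℕ.* 10 ℕ.^ c)
                       (count-mono (λ x → suc t ℕₚ.≤? (1 ℕ.+ ones x)) (λ x → t ℕₚ.≤? ones x)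
                                   (λ _ → ℕ.s≤s⁻¹) (bitVectors n)))
                    (ones-tail n t c le))
        (ones-tail n (suc t) c le)
    bound d@(no _) c le =
      outside (tail-count d) (manyOnes n (suc t)) (6 ℕ.^ suc t ℕ.* 10 ℕ.^ c)
              (5 ℕ.^ suc t ℕ.* 11 ℕ.^ c) (2 ℕ.^ n)
        (ones-tail n (suc t) c le) (ones-tail n (suc t) c le)

^-distribʳ-* : ∀ m x y → (x ℕ.* y) ℕ.^ m ≡ x ℕ.^ m ℕ.* y ℕ.^ m
^-distribʳ-* zero    x y = refl
^-distribʳ-* (suc m) x y = trans (cong (x ℕ.* y ℕ.*_) (^-distribʳ-* m x y))
                                 (interchange x y (x ℕ.^ m) (y ℕ.^ m))
  where
  interchange : ∀ x y a b → x ℕ.* y ℕ.* (a ℕ.* b) ≡ x ℕ.* a ℕ.* (y ℕ.* b)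
  interchange = solve-∀

-- From f/Z ≤ (c/a)^m and c/a ≤ y/x follows f/Z ≤ (y/x)^m. This replaces the unwieldy Chernoff ratio
-- by 22/23.
rescale-power : ∀ m f Z {a c x y} .⦃ _ : NonZero a ⦄ → c ℕ.* x ℕ.≤ y ℕ.* a →
                f ℕ.* a ℕ.^ m ℕ.≤ c ℕ.^ m ℕ.* Z → f ℕ.* x ℕ.^ m ℕ.≤ y ℕ.^ m ℕ.* Z
rescale-power m f Z {a} {c} {x} {y} ratio le = ℕₚ.*-cancelʳ-≤ _ _ (a ℕ.^ m) ⦃ ℕₚ.m^n≢0 a m ⦄ (begin
  f ℕ.* x ℕ.^ m ℕ.* a ℕ.^ m        ≡⟨ swap f (x ℕ.^ m) (a ℕ.^ m) ⟩
  f ℕ.* a ℕ.^ m ℕ.* x ℕ.^ m        ≤⟨ ℕₚ.*-monoˡ-≤ (x ℕ.^ m) le ⟩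
  c ℕ.^ m ℕ.* Z ℕ.* x ℕ.^ m        ≡⟨ swap (c ℕ.^ m) Z (x ℕ.^ m) ⟩
  c ℕ.^ m ℕ.* x ℕ.^ m ℕ.* Z        ≡⟨ cong (ℕ._* Z) (sym (^-distribʳ-* m c x)) ⟩
  (c ℕ.* x) ℕ.^ m ℕ.* Z            ≤⟨ ℕₚ.*-monoˡ-≤ Z (ℕₚ.^-monoˡ-≤ m ratio) ⟩
  (y ℕ.* a) ℕ.^ m ℕ.* Z            ≡⟨ cong (ℕ._* Z) (^-distribʳ-* m y a) ⟩
  y ℕ.^ m ℕ.* a ℕ.^ m ℕ.* Z        ≡⟨ swap (y ℕ.^ m) (a ℕ.^ m) Z ⟩
  y ℕ.^ m ℕ.* Z ℕ.* a ℕ.^ m        ∎)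
  where
  open ℕₚ.≤-Reasoning
  swap : ∀ x y z → x ℕ.* y ℕ.* z ≡ x ℕ.* z ℕ.* y
  swap = solve-∀

power-*-power : ∀ a p b q m → a ℕ.^ (p ℕ.* m) ℕ.* b ℕ.^ (q ℕ.* m) ≡ (a ℕ.^ p ℕ.* b ℕ.^ q) ℕ.^ m
power-*-power a p b q m = trans
  (cong₂ ℕ._*_ (sym (ℕₚ.^-*-assoc a p m)) (sym (ℕₚ.^-*-assoc b q m)))
  (sym (^-distribʳ-* m (a ℕ.^ p) (b ℕ.^ q)))

-- 5⁶ 11¹¹ / (6⁶ 10¹¹) ≤ 22/23.
block-tail : ∀ m t n →
  manyOnes (block? (11 ℕ.* m) t) n (6 ℕ.* m) ℕ.* 23 ℕ.^ m ℕ.≤ 22 ℕ.^ m ℕ.* 2 ℕ.^ n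
block-tail m t n = rescale-power m f (2 ℕ.^ n) {6 ℕ.^ 6 ℕ.* 10 ℕ.^ 11} {5 ℕ.^ 6 ℕ.* 11 ℕ.^ 11} {23} {22}
  (ℕₚ.≤ᵇ⇒≤ (5 ℕ.^ 6 ℕ.* 11 ℕ.^ 11 ℕ.* 23) (22 ℕ.* (6 ℕ.^ 6 ℕ.* 10 ℕ.^ 11)) tt)
  (subst₂ (λ x y → f ℕ.* x ℕ.≤ y ℕ.* 2 ℕ.^ n) (power-*-power 6 6 10 11 m) (power-*-power 5 6 11 11 m)
    (ones-tail (block? (11 ℕ.* m) t) n (6 ℕ.* m) (11 ℕ.* m) (block-size (11 ℕ.* m) t n)))
  where f = manyOnes (block? (11 ℕ.* m) t) n (6 ℕ.* m)

-- Union bound over the vertices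

sparseBlock? : ∀ b d t {n} → Decidable (SparseBlock b d t {n})
sparseBlock? b d t G =
  allᶠ? λ u → ((b ℕ.+ t) ℕₚ.≤? rev u) →-dec (degreeIn (block? b t) G u ℕₚ.≤? d)

-- The new vertex has `rev` equal to `n`. If an old `u` precedes the block, then b + t ≤ rev u < n,
-- so the new vertex is outside the block and adds nothing to the degree of `u`.
sparse-extend : ∀ b d t {n} (x : Vec Bool n) (G : Graph n) →
  ones (block? b t) x ℕ.≤ d → SparseBlock b d t G → SparseBlock b d t (extend x G)
sparse-extend b d t x G few sparse zero    le = few
sparse-extend b d t {n} x G few sparse (suc u) le = ℕₚ.≤-trans
  (ℕₚ.≤-reflexive (cong (ℕ._+ degreeIn (block? b t) G u)
    (indicator-no (T? (lookup x u) ×-dec block? b t n)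
      (λ (_ , _ , n<b+t) → ℕₚ.<-asym (rev<n u) (ℕₚ.<-≤-trans n<b+t le)))))
  (sparse u le)

-- Each added vertex contributes a failure probability of at most X/Y, and earlier failures keep
-- their probability.
not-sparse-count : ∀ b d t X Y →
  (∀ n → manyOnes (block? b t) n d ℕ.* Y ℕ.≤ X ℕ.* 2 ℕ.^ n) →
  ∀ n → count (¬? ∘ sparseBlock? b d t) (graphs n) ℕ.* Y ℕ.≤ n ℕ.* X ℕ.* length (graphs n)
not-sparse-count b d t X Y tail zero = ℕₚ.≤-reflexive (cong (ℕ._* Y) (ℕₚ.n≤0⇒n≡0 (begin
    count (¬? ∘ sparseBlock? b d t) (graphs 0)
      ≡⟨ count-∷ (¬? ∘ sparseBlock? b d t) empty [] ⟩
    indicator (¬? (sparseBlock? b d t empty)) ℕ.+ 0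
      ≡⟨ cong (ℕ._+ 0) (indicator-no (¬? (sparseBlock? b d t empty)) (λ ¬sparse → ¬sparse (λ ()))) ⟩
    0 ∎)))
  where open ℕₚ.≤-Reasoning
not-sparse-count b d t X Y tail (suc n) = begin
  count (¬? ∘ sparseBlock? b d t) (graphs (suc n)) ℕ.* Y
    ≤⟨ ℕₚ.*-monoˡ-≤ Y (count-cartesianProductWith (¬? ∘ sparseBlock? b d t)
         (λ x → d ℕₚ.≤? ones (block? b t) x) (¬? ∘ sparseBlock? b d t) extend split
         (bitVectors n) (graphs n)) ⟩
  (M ℕ.* L ℕ.+ length (bitVectors n) ℕ.* E) ℕ.* Y
    ≡⟨ cong (λ V → (M ℕ.* L ℕ.+ V ℕ.* E) ℕ.* Y) (length-bitVectors n) ⟩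
  (M ℕ.* L ℕ.+ 2 ℕ.^ n ℕ.* E) ℕ.* Y
    ≡⟨ lhs M L (2 ℕ.^ n) E Y ⟩
  (M ℕ.* Y) ℕ.* L ℕ.+ 2 ℕ.^ n ℕ.* (E ℕ.* Y)
    ≤⟨ ℕₚ.+-mono-≤ (ℕₚ.*-monoˡ-≤ L (tail n))
                   (ℕₚ.*-monoʳ-≤ (2 ℕ.^ n) (not-sparse-count b d t X Y tail n)) ⟩
  (X ℕ.* 2 ℕ.^ n) ℕ.* L ℕ.+ 2 ℕ.^ n ℕ.* (n ℕ.* X ℕ.* L)
    ≡⟨ rhs X (2 ℕ.^ n) L n ⟩
  suc n ℕ.* X ℕ.* (2 ℕ.^ n ℕ.* L)
    ≡⟨ cong (λ V → suc n ℕ.* X ℕ.* (V ℕ.* L)) (sym (length-bitVectors n)) ⟩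
  suc n ℕ.* X ℕ.* (length (bitVectors n) ℕ.* L)
    ≡⟨ cong (suc n ℕ.* X ℕ.*_) (sym (length-cartesianProductWith extend (bitVectors n) (graphs n))) ⟩
  suc n ℕ.* X ℕ.* length (graphs (suc n)) ∎
  where
  open ℕₚ.≤-Reasoning
  M = manyOnes (block? b t) n d
  L = length (graphs n)
  E = count (¬? ∘ sparseBlock? b d t) (graphs n)

  split : ∀ x G → ¬ SparseBlock b d t (extend x G) →
          d ℕ.≤ ones (block? b t) x ⊎ ¬ SparseBlock b d t G
  split x G ¬sparse with d ℕₚ.≤? ones (block? b t) x
  ... | yes le = inj₁ le
  ... | no ¬le = inj₂ (¬sparse ∘ sparse-extend b d t x G (ℕₚ.≰⇒≥ ¬le))

  lhs : ∀ M L V E Y → (M ℕ.* L ℕ.+ V ℕ.* E) ℕ.* Y ≡ (M ℕ.* Y) ℕ.* L ℕ.+ V ℕ.* (E ℕ.* Y)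
  lhs = solve-∀

  rhs : ∀ X V L n → (X ℕ.* V) ℕ.* L ℕ.+ V ℕ.* (n ℕ.* X ℕ.* L) ≡ (1 ℕ.+ n) ℕ.* X ℕ.* (V ℕ.* L)
  rhs = solve-∀

-- Rational estimates

toℚᵘ-/ : ∀ i d → ℚ.toℚᵘ (i ℚ./ suc d) ℚᵘ.≃ ℚᵘ.mkℚᵘ i d
toℚᵘ-/ i d = ℚₚ.toℚᵘ-fromℚᵘ (ℚᵘ.mkℚᵘ i d)

0≤p*q : ∀ {p q} → 0ℚ ℚ.≤ p → 0ℚ ℚ.≤ q → 0ℚ ℚ.≤ p ℚ.* q
0≤p*q {p} {q} 0≤p 0≤q = ℚₚ.nonNegative⁻¹ (p ℚ.* q)
  ⦃ ℚₚ.nonNeg*nonNeg⇒nonNeg p ⦃ ℚ.nonNegative 0≤p ⦄ q ⦃ ℚ.nonNegative 0≤q ⦄ ⦄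

0≤p+q : ∀ {p q} → 0ℚ ℚ.≤ p → 0ℚ ℚ.≤ q → 0ℚ ℚ.≤ p ℚ.+ q
0≤p+q = ℚₚ.+-mono-≤

p≤p+q : ∀ p {q} → 0ℚ ℚ.≤ q → p ℚ.≤ p ℚ.+ q
p≤p+q p {q} 0≤q = subst (ℚ._≤ p ℚ.+ q) (ℚₚ.+-identityʳ p) (ℚₚ.+-monoʳ-≤ p 0≤q)

-- 161/200 < (1 + √5)/4: with a = N/4 − H, b = N/4 and D = 161/200 N − H one has
-- 5 b² = a² + H D + 61/200 N D + 179/40000 N².
≤161/200⇒≤[1+√5]/4 : ∀ {H N} → 0ℚ ℚ.≤ H → 0ℚ ℚ.≤ N → H ℚ.≤ (pos 161 ℚ./ 200) ℚ.* N →
  fromℚ H ≤ (fromℕ 1 + fromℚ 0ℚ) * [1+√5]/4 * fromℚ N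
≤161/200⇒≤[1+√5]/4 {H} {N} 0≤H 0≤N H≤rN = inj₂ (inj₂ (0≤b , a²≤5b²))
  where
  open +-*-Solver
  ¼ = pos 1 ℚ./ 4
  five = pos 5 ℚ./ 1
  r = pos 161 ℚ./ 200
  D = r ℚ.* N ℚ.- H
  -- `a` and `b` are the two parts of N (1 + √5)/4 - H as the operations of `ℚ√5` compute them,
  -- hence the zero terms.
  a = ¼ ℚ.* N ℚ.+ five ℚ.* (¼ ℚ.* 0ℚ) ℚ.- H
  b = ¼ ℚ.* 0ℚ ℚ.+ ¼ ℚ.* N ℚ.- 0ℚ

  rest = H ℚ.* D ℚ.+ (pos 61 ℚ./ 200) ℚ.* (N ℚ.* D) ℚ.+ (pos 179 ℚ./ 40000) ℚ.* (N ℚ.* N)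

  0≤D : 0ℚ ℚ.≤ D
  0≤D = subst (ℚ._≤ D) (ℚₚ.+-inverseʳ H) (ℚₚ.+-monoˡ-≤ (ℚ.- H) H≤rN)

  0≤rest : 0ℚ ℚ.≤ rest
  0≤rest = 0≤p+q (0≤p+q (0≤p*q 0≤H 0≤D) (0≤p*q (ℚₚ.nonNegative⁻¹ (pos 61 ℚ./ 200)) (0≤p*q 0≤N 0≤D)))
                 (0≤p*q (ℚₚ.nonNegative⁻¹ (pos 179 ℚ./ 40000)) (0≤p*q 0≤N 0≤N))

  0≤b : 0ℚ ℚ.≤ b
  0≤b = 0≤p+q {¼ ℚ.* 0ℚ ℚ.+ ¼ ℚ.* N} {ℚ.- 0ℚ}
          (0≤p+q {¼ ℚ.* 0ℚ} {¼ ℚ.* N} ℚₚ.≤-refl (0≤p*q {¼} {N} (ℚₚ.nonNegative⁻¹ ¼) 0≤N)) ℚₚ.≤-refl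

  identity : a ℚ.* a ℚ.+ rest ≡ five ℚ.* (b ℚ.* b)
  identity = solve 2 (λ H N →
    let D = con r :* N :- H
        a = con ¼ :* N :+ con five :* (con ¼ :* con 0ℚ) :- H
        b = con ¼ :* con 0ℚ :+ con ¼ :* N :- con 0ℚ
    in a :* a :+ (H :* D :+ con (pos 61 ℚ./ 200) :* (N :* D) :+ con (pos 179 ℚ./ 40000) :* (N :* N))
       := con five :* (b :* b)) refl H N

  a²≤5b² : a ℚ.* a ℚ.≤ five ℚ.* (b ℚ.* b)
  a²≤5b² = subst (a ℚ.* a ℚ.≤_) identity (p≤p+q (a ℚ.* a) 0≤rest)

0≤fromℕ : ∀ n → 0ℚ ℚ.≤ pos n ℚ./ 1
0≤fromℕ n = ℚₚ.nonNegative⁻¹ (pos n ℚ./ 1) ⦃ ℚₚ.normalize-nonNeg n 1 ⦄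

fromℕ-≤[1+√5]/4 : ∀ h n → 200 ℕ.* h ℕ.≤ 161 ℕ.* n →
  fromℕ h ≤ (fromℕ 1 + fromℚ 0ℚ) * [1+√5]/4 * fromℕ n
fromℕ-≤[1+√5]/4 h n le = ≤161/200⇒≤[1+√5]/4 (0≤fromℕ h) (0≤fromℕ n) (ℚₚ.toℚᵘ-cancel-≤ (begin
  ℚ.toℚᵘ (pos h ℚ./ 1)
    ≃⟨ toℚᵘ-/ (pos h) 0 ⟩
  ℚᵘ.mkℚᵘ (pos h) 0
    ≤⟨ ℚᵘ.*≤* numerators ⟩
  ℚᵘ.mkℚᵘ (pos 161) 199 ℚᵘ.* ℚᵘ.mkℚᵘ (pos n) 0
    ≃⟨ ℚᵘₚ.*-congˡ {ℚᵘ.mkℚᵘ (pos 161) 199} (ℚᵘₚ.≃-sym (toℚᵘ-/ (pos n) 0)) ⟩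
  ℚᵘ.mkℚᵘ (pos 161) 199 ℚᵘ.* ℚ.toℚᵘ (pos n ℚ./ 1)
    ≃⟨ ℚᵘₚ.≃-sym (ℚₚ.toℚᵘ-homo-* (pos 161 ℚ./ 200) (pos n ℚ./ 1)) ⟩
  ℚ.toℚᵘ ((pos 161 ℚ./ 200) ℚ.* (pos n ℚ./ 1)) ∎))
  where
  open ℚᵘₚ.≤-Reasoning
  numerators : pos h ℤ.* pos 200 ℤ.≤ pos 161 ℤ.* pos n ℤ.* pos 1
  numerators = subst₂ ℤ._≤_ (ℤₚ.pos-* h 200)
    (trans (ℤₚ.pos-* 161 n) (sym (ℤₚ.*-identityʳ _)))
    (ℤ.+≤+ (subst (ℕ._≤ 161 ℕ.* n) (ℕₚ.*-comm 200 h) le))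

-- With ε = p/q and p ≥ 1: |g/t - 1| = b/t < 1/q ≤ ε.
close-to-one : ∀ g b {t} .⦃ _ : NonZero t ⦄ ε → 0ℚ ℚ.< ε → g ℕ.+ b ≡ t → b ℕ.* ℚ.↧ₙ ε ℕ.< t →
               ℚ.∣ pos g ℚ./ t ℚ.- 1ℚ ∣ ℚ.< ε
close-to-one g b {t@(suc t-1)} ε@(ℚ.mkℚ (pos p@(suc _)) q-1 _) 0<ε eq b<t =
  ℚₚ.toℚᵘ-cancel-< (begin-strict
  ℚ.toℚᵘ ℚ.∣ x ℚ.- 1ℚ ∣
    ≃⟨ ℚₚ.toℚᵘ-homo-∣-∣ (x ℚ.- 1ℚ) ⟩
  ℚᵘ.∣ ℚ.toℚᵘ (x ℚ.- 1ℚ) ∣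
    ≃⟨ ℚᵘₚ.∣-∣-cong (ℚₚ.toℚᵘ-homo-+ x (ℚ.- 1ℚ)) ⟩
  ℚᵘ.∣ ℚ.toℚᵘ x ℚᵘ.+ ℚ.toℚᵘ (ℚ.- 1ℚ) ∣
    ≃⟨ ℚᵘₚ.∣-∣-cong (ℚᵘₚ.+-congˡ (ℚ.toℚᵘ (ℚ.- 1ℚ)) (toℚᵘ-/ (pos g) t-1)) ⟩
  ℚᵘ.∣ ℚᵘ.mkℚᵘ (pos g) t-1 ℚᵘ.+ ℚ.toℚᵘ (ℚ.- 1ℚ) ∣
    <⟨ ℚᵘ.*<* numerators ⟩
  ℚ.toℚᵘ ε ∎)
  where
  open ℚᵘₚ.≤-Reasoning
  x = pos g ℚ./ t
  difference : ℤ.∣ pos g ℤ.* pos 1 ℤ.+ ℤ.-[1+ 0 ] ℤ.* pos t ∣ ≡ b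
  difference = trans (cong ℤ.∣_∣ (trans
      (cong₂ ℤ._+_ (ℤₚ.*-identityʳ (pos g)) (ℤₚ.-1*i≡-i (pos t)))
      (trans (ℤₚ.m-n≡m⊖n g t) (cong (g ℤ.⊖_) (sym eq)))))
    (trans (ℤₚ.∣⊖∣-≤ (ℕₚ.m≤m+n g b)) (ℕₚ.m+n∸m≡n g b))

  numerators : pos ℤ.∣ pos g ℤ.* pos 1 ℤ.+ ℤ.-[1+ 0 ] ℤ.* pos t ∣ ℤ.* pos (suc q-1) ℤ.<
               pos p ℤ.* pos (t ℕ.* 1)
  numerators = subst₂ ℤ._<_
    (trans (ℤₚ.pos-* b (suc q-1)) (cong (λ y → pos y ℤ.* pos (suc q-1)) (sym difference)))
    (ℤₚ.pos-* p (t ℕ.* 1))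
    (ℤ.+<+ (ℕₚ.<-≤-trans b<t (ℕₚ.≤-trans (ℕₚ.m≤n*m t p)
      (ℕₚ.≤-reflexive (cong (p ℕ.*_) (sym (ℕₚ.*-identityʳ t)))))))
close-to-one _ _ (ℚ.mkℚ (pos zero) _ _)   0<ε _ _ with () ← ℚ.positive 0<ε
close-to-one _ _ (ℚ.mkℚ ℤ.-[1+ _ ] _ _) 0<ε _ _ with () ← ℚ.positive 0<ε

-- The failure probability

-- Bernoulli's inequality (23/22)^m ≥ 1 + m/22.
23^m-linear : ∀ m → 22 ℕ.^ m ℕ.* (22 ℕ.+ m) ℕ.≤ 22 ℕ.* 23 ℕ.^ m
23^m-linear zero    = ℕₚ.≤-refl
23^m-linear (suc m) = begin
  22 ℕ.* a ℕ.* (22 ℕ.+ (1 ℕ.+ m))                  ≤⟨ ℕₚ.m≤m+n _ (a ℕ.* m) ⟩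
  22 ℕ.* a ℕ.* (22 ℕ.+ (1 ℕ.+ m)) ℕ.+ a ℕ.* m      ≡⟨ lhs a m ⟩
  23 ℕ.* (a ℕ.* (22 ℕ.+ m))                        ≤⟨ ℕₚ.*-monoʳ-≤ 23 (23^m-linear m) ⟩
  23 ℕ.* (22 ℕ.* 23 ℕ.^ m)                         ≡⟨ swap 23 22 (23 ℕ.^ m) ⟩
  22 ℕ.* (23 ℕ.* 23 ℕ.^ m)                         ∎
  where
  open ℕₚ.≤-Reasoning
  a = 22 ℕ.^ m
  lhs : ∀ a m → 22 ℕ.* a ℕ.* (22 ℕ.+ (1 ℕ.+ m)) ℕ.+ a ℕ.* m ≡ 23 ℕ.* (a ℕ.* (22 ℕ.+ m))
  lhs = solve-∀

  swap : ∀ x y e → x ℕ.* (y ℕ.* e) ≡ y ℕ.* (x ℕ.* e)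
  swap = solve-∀

-- The quadratic term of the binomial expansion of (1 + 1/22)^(m+1), with 968 = 2 · 22². Quadratic
-- growth beats the factor `n` of the union bound, which is linear in `m`.
23^m-quadratic : ∀ m → 22 ℕ.^ suc m ℕ.* (suc m ℕ.* m) ℕ.≤ 23 ℕ.^ suc m ℕ.* 968
23^m-quadratic zero    = z≤n
23^m-quadratic (suc m) = begin
  22 ℕ.* a ℕ.* ((2 ℕ.+ m) ℕ.* (1 ℕ.+ m))
    ≡⟨ lhs a m ⟩
  22 ℕ.* (a ℕ.* ((1 ℕ.+ m) ℕ.* m)) ℕ.+ 44 ℕ.* (a ℕ.* (1 ℕ.+ m))
    ≤⟨ ℕₚ.+-mono-≤ (ℕₚ.*-monoʳ-≤ 22 (23^m-quadratic m))
         (ℕₚ.*-monoʳ-≤ 44 (ℕₚ.≤-trans (ℕₚ.*-monoʳ-≤ a (ℕₚ.m≤n+m (1 ℕ.+ m) 22)) (23^m-linear (suc m)))) ⟩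
  22 ℕ.* (e ℕ.* 968) ℕ.+ 44 ℕ.* (22 ℕ.* e)
    ≡⟨ rhs e 44 22 ⟩
  23 ℕ.* e ℕ.* 968 ∎
  where
  open ℕₚ.≤-Reasoning
  a = 22 ℕ.^ suc m
  e = 23 ℕ.^ suc m
  lhs : ∀ a m → 22 ℕ.* a ℕ.* ((2 ℕ.+ m) ℕ.* (1 ℕ.+ m)) ≡
                22 ℕ.* (a ℕ.* ((1 ℕ.+ m) ℕ.* m)) ℕ.+ 44 ℕ.* (a ℕ.* (1 ℕ.+ m))
  lhs = solve-∀

  rhs : ∀ e x y → 22 ℕ.* (e ℕ.* (x ℕ.* y)) ℕ.+ x ℕ.* (y ℕ.* e) ≡ 23 ℕ.* e ℕ.* (x ℕ.* y)
  rhs = solve-∀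

-- 266200 = 968 · 5 · 55.
failure-vanishes : ∀ n q m → n ℕ.≤ 55 ℕ.* suc m → q ℕ.* 266200 ℕ.< m →
                   5 ℕ.* (n ℕ.* 22 ℕ.^ suc m) ℕ.* q ℕ.< 23 ℕ.^ suc m
failure-vanishes n q m n≤ q< = ℕₚ.*-cancelʳ-< 968 _ _ (begin-strict
  5 ℕ.* (n ℕ.* a) ℕ.* q ℕ.* 968
    ≤⟨ ℕₚ.*-monoˡ-≤ 968 (ℕₚ.*-monoˡ-≤ q (ℕₚ.*-monoʳ-≤ 5 (ℕₚ.*-monoˡ-≤ a n≤))) ⟩
  5 ℕ.* (55 ℕ.* suc m ℕ.* a) ℕ.* q ℕ.* 968
    ≡⟨ regroup a (suc m) q 5 55 968 ⟩
  a ℕ.* (suc m ℕ.* (q ℕ.* 266200))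
    <⟨ ℕₚ.*-monoʳ-< a ⦃ ℕₚ.m^n≢0 22 (suc m) ⦄ (ℕₚ.*-monoʳ-< (suc m) q<) ⟩
  a ℕ.* (suc m ℕ.* m)
    ≤⟨ 23^m-quadratic m ⟩
  23 ℕ.^ suc m ℕ.* 968 ∎)
  where
  open ℕₚ.≤-Reasoning
  a = 22 ℕ.^ suc m
  regroup : ∀ a m q x y z →
            x ℕ.* (y ℕ.* m ℕ.* a) ℕ.* q ℕ.* z ≡ a ℕ.* (m ℕ.* (q ℕ.* (x ℕ.* y ℕ.* z)))
  regroup = solve-∀

balanced? : ∀ m {n} → Decidable (Balanced m {n})
balanced? m G = allᶠ? λ j → sparseBlock? (11 ℕ.* m) (6 ℕ.* m) (toℕ j ℕ.* (11 ℕ.* m)) G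

-- A union bound over the five blocks, each failing with probability at most n (22/23)^m.
not-balanced-count : ∀ m n → count (¬? ∘ balanced? m) (graphs n) ℕ.* 23 ℕ.^ m ℕ.≤
                             5 ℕ.* (n ℕ.* 22 ℕ.^ m ℕ.* length (graphs n))
not-balanced-count m n = begin
  count (¬? ∘ balanced? m) (graphs n) ℕ.* 23 ℕ.^ m
    ≤⟨ ℕₚ.*-monoˡ-≤ (23 ℕ.^ m) (count-¬∀ sparse? (graphs n)) ⟩
  sum (λ j → count (¬? ∘ sparse? j) (graphs n)) ℕ.* 23 ℕ.^ m
    ≡⟨ ℕₚ.*-comm _ (23 ℕ.^ m) ⟩
  23 ℕ.^ m ℕ.* sum (λ j → count (¬? ∘ sparse? j) (graphs n))
    ≡⟨ sym (sum-* 5 (23 ℕ.^ m) (λ j → count (¬? ∘ sparse? j) (graphs n))) ⟩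
  sum (λ j → 23 ℕ.^ m ℕ.* count (¬? ∘ sparse? j) (graphs n))
    ≤⟨ sum-mono {5} (λ j → ℕₚ.≤-trans
         (ℕₚ.≤-reflexive (ℕₚ.*-comm (23 ℕ.^ m) (count (¬? ∘ sparse? j) (graphs n))))
         (not-sparse-count b (6 ℕ.* m) (toℕ j ℕ.* b) (22 ℕ.^ m) (23 ℕ.^ m)
           (block-tail m (toℕ j ℕ.* b)) n)) ⟩
  sum {5} (λ _ → n ℕ.* 22 ℕ.^ m ℕ.* length (graphs n))
    ≡⟨ sum-const 5 (n ℕ.* 22 ℕ.^ m ℕ.* length (graphs n)) ⟩
  5 ℕ.* (n ℕ.* 22 ℕ.^ m ℕ.* length (graphs n)) ∎
  where
  open ℕₚ.≤-Reasoning
  b = 11 ℕ.* m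
  sparse? : (j : Fin 5) → Decidable (SparseBlock b (6 ℕ.* m) (toℕ j ℕ.* b) {n})
  sparse? j = sparseBlock? b (6 ℕ.* m) (toℕ j ℕ.* b)

n≤55*[1+n/55] : ∀ n → n ℕ.≤ 55 ℕ.* suc (n ℕ./ 55)
n≤55*[1+n/55] n = begin
  n                                  ≡⟨ m≡m%n+[m/n]*n n 55 ⟩
  n ℕ.% 55 ℕ.+ n ℕ./ 55 ℕ.* 55       ≤⟨ ℕₚ.+-monoˡ-≤ (n ℕ./ 55 ℕ.* 55) (ℕₚ.<⇒≤ (m%n<n n 55)) ⟩
  suc (n ℕ./ 55) ℕ.* 55              ≡⟨ ℕₚ.*-comm (suc (n ℕ./ 55)) 55 ⟩
  55 ℕ.* suc (n ℕ./ 55)              ∎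
  where open ℕₚ.≤-Reasoning

-- Rounding n/55 up costs at most 44 colours: 44 (1 + n/55) ≤ 4n/5 + 44, and 44 ≤ n/200 once n ≥
-- 8800. Then 4/5 + 1/200 = 161/200.
balanced⇒HG-bound : ∀ {n} (G : Graph n) → 8800 ℕ.≤ n → Balanced (suc (n ℕ./ 55)) G →
                    fromℕ (HG G) ≤ (fromℕ 1 + fromℚ 0ℚ) * [1+√5]/4 * fromℕ n
balanced⇒HG-bound {n} G 8800≤n balanced = fromℕ-≤[1+√5]/4 (HG G) n (begin
  200 ℕ.* HG G
    ≤⟨ ℕₚ.*-monoʳ-≤ 200 (ℕₚ.≰⇒≥ 44m≰HG) ⟩
  200 ℕ.* (44 ℕ.* suc (n ℕ./ 55))
    ≡⟨ expand (n ℕ./ 55) 200 44 ⟩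
  n ℕ./ 55 ℕ.* (55 ℕ.* 160) ℕ.+ 8800
    ≡⟨ cong (ℕ._+ 8800) (sym (ℕₚ.*-assoc (n ℕ./ 55) 55 160)) ⟩
  n ℕ./ 55 ℕ.* 55 ℕ.* 160 ℕ.+ 8800
    ≤⟨ ℕₚ.+-mono-≤ (ℕₚ.*-monoˡ-≤ 160 (m/n*n≤m n 55)) 8800≤n ⟩
  n ℕ.* 160 ℕ.+ n
    ≡⟨ trans (ℕₚ.+-comm (n ℕ.* 160) n) (cong (n ℕ.+_) (ℕₚ.*-comm n 160)) ⟩
  161 ℕ.* n ∎)
  where
  open ℕₚ.≤-Reasoning
  expand : ∀ x y z → y ℕ.* (z ℕ.* (1 ℕ.+ x)) ≡ x ℕ.* (y ℕ.* z) ℕ.+ y ℕ.* z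
  expand = solve-∀

  -- `HG G` colours do admit a winning strategy, so `balanced⇒no-winning` is applied with k =
  -- `HG G`.
  44m≰HG : ¬ 44 ℕ.* suc (n ℕ./ 55) ℕ.≤ HG G
  44m≰HG le = balanced⇒no-winning (suc (n ℕ./ 55)) G 1≤HG (n≤55*[1+n/55] n) le balanced
                (greatest-holds (hasWinningStrategy? G) n 1≤HG)
    where
    1≤HG : 1 ℕ.≤ HG G
    1≤HG = ℕₚ.≤-trans (s≤s z≤n) le

HG-bound? : ∀ n (G : Graph n) →
  Dec (fromℕ (HG G) ≤ (fromℕ 1 + fromℚ 0ℚ) * [1+√5]/4 * fromℕ n)
HG-bound? n G = fromℕ (HG G) ≤? (fromℕ 1 + fromℚ 0ℚ) * [1+√5]/4 * fromℕ n

-- The summand 8800 serves `balanced⇒HG-bound`; the other one ensures n/55 > 266200 q, as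
-- `failure-vanishes` requires.
HG-bound-fails : ∀ n q → suc (q ℕ.* 266200) ℕ.* 55 ℕ.+ 8800 ℕ.≤ n →
                 count (¬? ∘ HG-bound? n) (graphs n) ℕ.* q ℕ.< length (graphs n)
HG-bound-fails n q n≥ = ℕₚ.*-cancelʳ-< (23 ℕ.^ m) _ _ (begin-strict
  F ℕ.* q ℕ.* 23 ℕ.^ m
    ≤⟨ ℕₚ.*-monoˡ-≤ (23 ℕ.^ m) (ℕₚ.*-monoˡ-≤ q (count-mono (¬? ∘ HG-bound? n) (¬? ∘ balanced? m)
         (λ G fails → fails ∘ balanced⇒HG-bound G 8800≤n) (graphs n))) ⟩
  U ℕ.* q ℕ.* 23 ℕ.^ m
    ≡⟨ swap U q (23 ℕ.^ m) ⟩
  U ℕ.* 23 ℕ.^ m ℕ.* q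
    ≤⟨ ℕₚ.*-monoˡ-≤ q (not-balanced-count m n) ⟩
  5 ℕ.* (n ℕ.* 22 ℕ.^ m ℕ.* L) ℕ.* q
    ≡⟨ regroup n (22 ℕ.^ m) L q ⟩
  L ℕ.* (5 ℕ.* (n ℕ.* 22 ℕ.^ m) ℕ.* q)
    <⟨ ℕₚ.*-monoʳ-< L ⦃ nonZero ⦄ (failure-vanishes n q (n ℕ./ 55) (n≤55*[1+n/55] n) q<n/55) ⟩
  L ℕ.* 23 ℕ.^ m ∎)
  where
  open ℕₚ.≤-Reasoning
  m = suc (n ℕ./ 55)
  F = count (¬? ∘ HG-bound? n) (graphs n)
  U = count (¬? ∘ balanced? m) (graphs n)
  L = length (graphs n)

  8800≤n : 8800 ℕ.≤ n
  8800≤n = ℕₚ.≤-trans (ℕₚ.m≤n+m 8800 (suc (q ℕ.* 266200) ℕ.* 55)) n≥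

  q<n/55 : q ℕ.* 266200 ℕ.< n ℕ./ 55
  q<n/55 = subst (ℕ._≤ n ℕ./ 55) (m*n/n≡m (suc (q ℕ.* 266200)) 55)
    (/-monoˡ-≤ 55 (ℕₚ.≤-trans (ℕₚ.m≤m+n (suc (q ℕ.* 266200) ℕ.* 55) 8800) n≥))

  nonZero : NonZero L
  nonZero = subst NonZero (sym (length-graphs n)) (ℕₚ.m^n≢0 2 (n C 2))

  swap : ∀ x y z → x ℕ.* y ℕ.* z ≡ x ℕ.* z ℕ.* y
  swap = solve-∀

  regroup : ∀ n a L q → 5 ℕ.* (n ℕ.* a ℕ.* L) ℕ.* q ≡ L ℕ.* (5 ℕ.* (n ℕ.* a) ℕ.* q)
  regroup = solve-∀

corollary1 : ∃ λ (δ : ℕ → ℚ) →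
    (δ ⟶ 0ℚ) ×
    WithHighProbability
    {λ n G → fromℕ (HG G) ≤ (fromℕ 1 + fromℚ (δ n)) * [1+√5]/4 * fromℕ n}
    (λ n G → fromℕ (HG G) ≤? (fromℕ 1 + fromℚ (δ n)) * [1+√5]/4 * fromℕ n)
-- The distance of δ from its limit evaluates to 0, so `0<ε` itself is the required bound. In the
-- second limit q is the denominator of ε.
corollary1 = (λ _ → 0ℚ) , (λ ε 0<ε → 0 , λ _ _ → 0<ε) , λ ε 0<ε →
  suc (ℚ.↧ₙ ε ℕ.* 266200) ℕ.* 55 ℕ.+ 8800 , λ n n≥ →
    close-to-one (count (HG-bound? n) (graphs n)) (count (¬? ∘ HG-bound? n) (graphs n))
      ⦃ ℕₚ.m^n≢0 2 (n C 2) ⦄ ε 0<ε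
      (trans (count-complement (HG-bound? n) (graphs n)) (length-graphs n))
      (subst (count (¬? ∘ HG-bound? n) (graphs n) ℕ.* ℚ.↧ₙ ε ℕ.<_) (length-graphs n)
        (HG-bound-fails n (ℚ.↧ₙ ε) n≥))
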